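{- Fix an integer $q\ge 2$ and positive integers $1\le m_1\le\cdots\le m_{q+1}$. Put $a=m_1$, $b=m_2$, $H=K_{a,b}$, $F=K_{m_1,\ldots,m_{q+1}}$. For every $\delta>0$ there exists $n_0=n_0(q,m_1,\ldots,m_{q+1},\delta)$ such that the following holds. Let $T$ be an $n$-vertex tree with $n\ge n_0$, put \[ r=R(T,H),\qquad N=q(r-1)+a, \] and let $G$ be a graph on $N$ vertices with complement $\overline{G}$. If $F\nsubseteq\overline{G}$ (that is, $\overline G$ contains no copy of $F$) and \[ e(G)\ge\binom N2-t_q(N)+\delta N^2, \] then $G$ contains a copy of $T$. (The threshold $n_0$ is uniform over all $n$-vertex trees $T$.)
   Context: All graphs are finite and simple; copies of graphs are ordinary (not necessarily induced) copies. For graphs $J$ and $L$, $R(J,L)$ is the least $N$ such that every red--blue coloring of the edges of $K_N$ contains a red copy of $J$ or a blue copy of $L$. $K_{m_1,\ldots,m_{q+1}}$ is the complete $(q+1)$-partite graph with part sizes $m_1,\ldots,m_{q+1}$. $e(G)$ is the number of edges of $G$, and $t_q(N)$ is the number of edges in the balanced $q$-partite Turán graph on $N$ vertices. -}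

module Defs where

open import Data.Bool using (Bool; true; false; not; _∧_)
open import Data.Bool.Properties using (∧-zeroʳ)
open import Data.Fin using (Fin; zero; suc; toℕ; fromℕ; inject₁)
import Data.Fin as Fin
open import Data.Integer using (+_)
open import Data.List using (length; filterᵇ; cartesianProduct; allFin)
open import Data.Nat using (ℕ; _+_; _≤_; _<ᵇ_; _%_; NonZero)
import Data.Nat as ℕ
open import Data.Product using (Σ; Σ-syntax; ∃-syntax; _×_; _,_; proj₁)
open import Data.Rational using (ℚ)
open import Data.Rational.Literals using (fromℤ)
open import Data.Sum using (_⊎_)
open import Data.Vec.Functional using (Vector; _∷_; [])
open import Function using (_∘_; mk⇔)
open import Function.Definitions using (Injective)
open import Relation.Binary using (DecidableEquality)
open import Relation.Binary.Construct.Closure.ReflexiveTransitive using (Star)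
open import Relation.Binary.PropositionalEquality
  using (_≡_; refl; sym; cong; cong₂; trans)
open import Relation.Nullary using (¬_; does)
open import Relation.Nullary.Decidable using (dec-true; does-⇔)

record Graph (V : Set) : Set where
  field
    adj        : V → V → Bool
    adj-sym    : ∀ u v → adj u v ≡ adj v u
    adj-irrefl : ∀ v → adj v v ≡ false

  Edge : V → V → Set
  Edge u v = adj u v ≡ true

open Graph public

private
  variable
    V W C : Set

-- Copies are not required to be induced: non-edges may map to edges.
Contains : Graph V → Graph W → Set
Contains {V} {W} G H =
  Σ[ f ∈ (W → V) ] Injective _≡_ _≡_ f × (∀ {u v} → Edge H u v → Edge G (f u) (f v))

private
  does-≟-sym : (_≟_ : DecidableEquality C) → ∀ x y → does (x ≟ y) ≡ does (y ≟ x)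
  does-≟-sym _≟_ x y = does-⇔ (mk⇔ sym sym) (x ≟ y) (y ≟ x)

complement : ∀ {N} → Graph (Fin N) → Graph (Fin N)
complement G .adj u v = not (adj G u v) ∧ not (does (u Fin.≟ v))
complement G .adj-sym u v =
  cong₂ (λ x y → not x ∧ not y) (adj-sym G u v) (does-≟-sym Fin._≟_ u v)
complement G .adj-irrefl v =
  trans (cong (λ x → not (adj G v v) ∧ not x) (dec-true (v Fin.≟ v) refl))
        (∧-zeroʳ _)

-- Distinct vertices are adjacent exactly when they lie in different parts,
-- the part of v being `part v`.
multipartite : DecidableEquality C → (V → C) → Graph V
multipartite _≟_ part .adj u v = not (does (part u ≟ part v))
multipartite _≟_ part .adj-sym u v = cong not (does-≟-sym _≟_ (part u) (part v))
multipartite _≟_ part .adj-irrefl v = cong not (dec-true (part v ≟ part v) refl)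

K : ∀ {k} (m : Vector ℕ k) → Graph (Σ[ i ∈ Fin k ] Fin (m i))
K m = multipartite Fin._≟_ proj₁

K₂ : (a b : ℕ) → Graph (Σ[ i ∈ Fin 2 ] Fin ((a ∷ b ∷ []) i))
K₂ a b = K (a ∷ b ∷ [])

-- Residue classes mod q split {0, …, N-1} into q parts of sizes differing by
-- at most one.
turánGraph : (q N : ℕ) → .{{NonZero q}} → Graph (Fin N)
turánGraph q N = multipartite ℕ._≟_ (λ v → toℕ v % q)

-- Each edge is counted once, as the pair (u , v) with u < v.
e : ∀ {N} → Graph (Fin N) → ℕ
e {N} G = length (filterᵇ (λ (u , v) → (toℕ u <ᵇ toℕ v) ∧ adj G u v)
                          (cartesianProduct (allFin N) (allFin N)))

t : (q N : ℕ) → .{{NonZero q}} → ℕ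
t q N = e (turánGraph q N)

Connected : Graph V → Set
Connected {V} G = V × (∀ u v → Star (Edge G) u v)

-- A cycle v₀ v₁ … vₖ₊₂ on k + 3 ≥ 3 distinct vertices.
Cycle : Graph V → Set
Cycle {V} G =
  ∃[ k ] Σ[ v ∈ (Fin (3 + k) → V) ]
    Injective _≡_ _≡_ v
    × (∀ (i : Fin (2 + k)) → Edge G (v (inject₁ i)) (v (suc i)))
    × Edge G (v (fromℕ (2 + k))) (v zero)

IsTree : Graph V → Set
IsTree G = Connected G × ¬ Cycle G

-- A red–blue colouring of the edges of K_N is given by its graph of red edges;
-- the blue edges are then those of the complement.
Arrows : ℕ → Graph V → Graph W → Set
Arrows N J L = (red : Graph (Fin N)) → Contains red J ⊎ Contains (complement red) L

-- r = R(J, L)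
IsRamseyNumber : Graph V → Graph W → ℕ → Set
IsRamseyNumber J L r = Arrows r J L × (∀ N → Arrows N J L → r ≤ N)

ℕ→ℚ : ℕ → ℚ
ℕ→ℚ n = fromℤ (+ n)

{-# OPTIONS --safe #-}
module Submission where

-- Suppose T ⊈ G, and write Ḡ for the complement. Supersaturation: since F ⊈ Ḡ, the
-- graph Ḡ has only o(n^(q+1)) cliques of order q + 1. To contradict this, count
-- cliques of Ḡ by their first vertex: v ∈ S followed by a clique in S ∖ N(v). As T
-- embeds greedily into any graph of minimum degree n, every large S has linearly many v
-- of degree at most n + o(n) in S, so each step shrinks S by about n only; but since
-- N is about q n, nothing but o(n) vertices is guaranteed after q steps. If S contains
-- no near-clique (a set A of about n vertices with minimum degree n - o(n)), the last
-- step still succeeds, because a set of about n vertices then has quadratically many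
-- non-edges.
-- If S contains a near-clique A, no u ∈ A has linearly many neighbours outside A:
-- T has a vertex w and a union of branches at w of small linear size, so one could put
-- w at u, the branches in a subgraph of large minimum degree of N(u) ∖ A, and the rest
-- of T in A. Hence the vertices of A have degree at most n + o(n). By the assumption on
-- e(G) and r ≥ n, a linear set D of vertices has degree at least n + Δ; it is disjoint
-- from A and keeps most of its vertices in S ∖ N(v) for v ∈ A. Using such v as first
-- vertices, the surviving part of D is the linear set needed at the end.

open import Defs
open import Data.Bool using (Bool; true; false; not; _∧_; _∨_; if_then_else_)
import Data.Bool as Bool
open import Data.Bool.Properties using (∨-zeroʳ)
open import Data.Empty using (⊥; ⊥-elim)
open import Data.Fin using (Fin; zero; suc; toℕ; fromℕ; inject₁)
import Data.Fin as Fin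
import Data.Fin.Properties as Fin
import Data.Integer as ℤ
import Data.Integer.Properties as ℤ
import Data.Integer.Tactic.RingSolver as ℤ-Solver
open import Data.List using (List; []; _∷_; _∷ʳ_; _++_; map; filter; filterᵇ; length; lookup; tabulate; allFin; cartesianProduct; cartesianProductWith)
open import Data.List.Properties using (length-map; length-tabulate; map-tabulate)
open import Data.List.Membership.Propositional using (_∈_; _∉_)
open import Data.List.Membership.Propositional.Properties using (∈-map⁺; ∈-lookup; ∈-filter⁺; ∈-filter⁻)
open import Data.List.Relation.Unary.All using (All; []; _∷_)
import Data.List.Relation.Unary.All as All
import Data.List.Relation.Unary.All.Properties as All
open import Data.List.Relation.Unary.Any using (here; there)
open import Data.List.Relation.Unary.Unique.Propositional using (Unique; []; _∷_)
import Data.List.Relation.Unary.Unique.Propositional.Properties as Unique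
open import Data.Nat using (ℕ; zero; suc; _+_; _*_; _∸_; _^_; _/_; _%_; _≤_; _<_; _≤?_; _<?_; _<ᵇ_; z≤n; s≤s; s≤s⁻¹; NonZero; >-nonZero)
import Data.Nat as ℕ
open import Data.Nat.Combinatorics using (_C_; nC1≡n; nCk+nC[k+1]≡[n+1]C[k+1])
open import Data.Nat.DivMod using (m≡m%n+[m/n]*n; m%n<n; m/n*n≤m; m<n⇒m%n≡m; [m+kn]%n≡m%n)
open import Data.Nat.Properties
open import Data.Nat.Tactic.RingSolver using (solve-∀)
open import Data.Product using (∃; ∃-syntax; Σ-syntax; _×_; _,_; proj₁; proj₂)
open import Data.Rational using (ℚ; mkℚ; 0ℚ; toℚᵘ)
import Data.Rational as ℚ
import Data.Rational.Properties as ℚ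
open import Data.Rational.Unnormalised using (*≤*)
import Data.Rational.Unnormalised as ℚᵘ
import Data.Rational.Unnormalised.Properties as ℚᵘ
open import Data.Sum using (_⊎_; inj₁; inj₂)
open import Data.Vec using (Vec; []; _∷_)
import Data.Vec as Vec
import Data.Vec.Properties as Vec
open import Data.Vec.Functional using (Vector)
import Data.Vec.Functional as Func
open import Function using (_∘_; id)
open import Function.Definitions using (Injective)
open import Relation.Binary.Construct.Closure.ReflexiveTransitive using (Star; ε; _◅_)
open import Relation.Binary.PropositionalEquality using (_≡_; _≢_; _≗_; refl; sym; trans; cong; cong₂; subst; subst₂)
open import Relation.Nullary using (¬_; Dec; yes; no; does)
open import Relation.Nullary.Decidable using (dec-true; dec-false; decidable-stable; map′; _×-dec_; _→-dec_)

-- An inequality follows from l ≤ r as soon as it does so by adding l ≤ r to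
-- both sides, which leaves a semiring identity with explicit slack k.
linear : ∀ {l r a b} k → l ≤ r → a + r + k ≡ b + l → a ≤ b
linear {l} {r} {a} {b} k l≤r eq = +-cancelʳ-≤ l a b (begin
  a + l      ≤⟨ +-monoʳ-≤ a l≤r ⟩
  a + r      ≤⟨ m≤m+n (a + r) k ⟩
  a + r + k  ≡⟨ eq ⟩
  b + l      ∎)
  where open ≤-Reasoning

infixr 6 _⊕_
_⊕_ : ∀ {a b c d} → a ≤ b → c ≤ d → a + c ≤ b + d
_⊕_ = +-mono-≤

-- Finite sums and indicators

∑ : ∀ {A : Set} → List A → (A → ℕ) → ℕ
∑ []       f = 0
∑ (x ∷ xs) f = f x + ∑ xs f

𝟙 : Bool → ℕ
𝟙 true  = 1
𝟙 false = 0

module _ {A : Set} where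

  ∑-cong : ∀ (xs : List A) {f g} → (∀ x → f x ≡ g x) → ∑ xs f ≡ ∑ xs g
  ∑-cong []       eq = refl
  ∑-cong (x ∷ xs) eq = cong₂ _+_ (eq x) (∑-cong xs eq)

  ∑-mono : ∀ (xs : List A) {f g} → (∀ x → f x ≤ g x) → ∑ xs f ≤ ∑ xs g
  ∑-mono []       le = z≤n
  ∑-mono (x ∷ xs) le = +-mono-≤ (le x) (∑-mono xs le)

  ∑-+ : ∀ (xs : List A) (f g : A → ℕ) → ∑ xs (λ x → f x + g x) ≡ ∑ xs f + ∑ xs g
  ∑-+ []       f g = refl
  ∑-+ (x ∷ xs) f g = trans (cong (f x + g x +_) (∑-+ xs f g)) (lemma (f x) (g x) (∑ xs f) (∑ xs g))
    where
    lemma : ∀ a b c d → a + b + (c + d) ≡ a + c + (b + d)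
    lemma = solve-∀

  ∑-*ˡ : ∀ (xs : List A) c (f : A → ℕ) → ∑ xs (λ x → c * f x) ≡ c * ∑ xs f
  ∑-*ˡ []       c f = sym (*-zeroʳ c)
  ∑-*ˡ (x ∷ xs) c f = trans (cong (c * f x +_) (∑-*ˡ xs c f)) (sym (*-distribˡ-+ c (f x) (∑ xs f)))

  ∑-*ʳ : ∀ (xs : List A) c (f : A → ℕ) → ∑ xs (λ x → f x * c) ≡ ∑ xs f * c
  ∑-*ʳ xs c f = trans (∑-cong xs (λ x → *-comm (f x) c)) (trans (∑-*ˡ xs c f) (*-comm c (∑ xs f)))

  ∑-const : ∀ (xs : List A) c → ∑ xs (λ _ → c) ≡ length xs * c
  ∑-const []       c = refl
  ∑-const (x ∷ xs) c = cong (c +_) (∑-const xs c)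

  ∑-zero : ∀ (xs : List A) → ∑ xs (λ _ → 0) ≡ 0
  ∑-zero xs = trans (∑-const xs 0) (*-zeroʳ (length xs))

  ∑-++ : ∀ (xs ys : List A) f → ∑ (xs ++ ys) f ≡ ∑ xs f + ∑ ys f
  ∑-++ []       ys f = refl
  ∑-++ (x ∷ xs) ys f = trans (cong (f x +_) (∑-++ xs ys f)) (sym (+-assoc (f x) (∑ xs f) (∑ ys f)))

  ∑-pick : ∀ (xs : List A) (f g : A → ℕ) → ∑ xs f < ∑ xs g → ∃[ x ] f x < g x
  ∑-pick []       f g ()
  ∑-pick (x ∷ xs) f g lt with f x <? g x
  ... | yes fx<gx = x , fx<gx
  ... | no  fx≮gx = ∑-pick xs f g (+-cancelˡ-< (f x) _ _ (begin-strict
          f x + ∑ xs f  <⟨ lt ⟩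
          g x + ∑ xs g  ≤⟨ +-monoˡ-≤ (∑ xs g) (≮⇒≥ fx≮gx) ⟩
          f x + ∑ xs g  ∎))
    where open ≤-Reasoning

  length-filterᵇ : ∀ (xs : List A) p → length (filterᵇ p xs) ≡ ∑ xs (𝟙 ∘ p)
  length-filterᵇ []       p = refl
  length-filterᵇ (x ∷ xs) p with p x
  ... | true  = cong suc (length-filterᵇ xs p)
  ... | false = length-filterᵇ xs p

∑-map : ∀ {A B : Set} (xs : List A) (h : A → B) f → ∑ (map h xs) f ≡ ∑ xs (f ∘ h)
∑-map []       h f = refl
∑-map (x ∷ xs) h f = cong (f (h x) +_) (∑-map xs h f)

∑-swap : ∀ {A B : Set} (xs : List A) (ys : List B) (f : A → B → ℕ) →
         ∑ xs (λ x → ∑ ys (f x)) ≡ ∑ ys (λ y → ∑ xs (λ x → f x y))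
∑-swap []       ys f = sym (∑-zero ys)
∑-swap (x ∷ xs) ys f = trans (cong (∑ ys (f x) +_) (∑-swap xs ys f))
                             (sym (∑-+ ys (f x) (λ y → ∑ xs (λ x → f x y))))

∑-product : ∀ {A B D : Set} (h : A → B → D) (xs : List A) (ys : List B) f →
            ∑ (cartesianProductWith h xs ys) f ≡ ∑ xs (λ x → ∑ ys (λ y → f (h x y)))
∑-product h []       ys f = refl
∑-product h (x ∷ xs) ys f =
  trans (∑-++ (map (h x) ys) (cartesianProductWith h xs ys) f)
        (cong₂ _+_ (∑-map ys (h x) f) (∑-product h xs ys f))

𝟙-mono : ∀ {a b} → (a ≡ true → b ≡ true) → 𝟙 a ≤ 𝟙 b
𝟙-mono {false} h = z≤n
𝟙-mono {true}  h rewrite h refl = ≤-refl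

∧-true : ∀ {a b} → a ∧ b ≡ true → a ≡ true × b ≡ true
∧-true {true} {true} refl = refl , refl

true-∧ : ∀ {a b} → a ≡ true → b ≡ true → a ∧ b ≡ true
true-∧ refl refl = refl

true≢false : ∀ {b} → b ≡ true → b ≡ false → ⊥
true≢false refl ()

dichotomy : ∀ b → b ≡ true ⊎ b ≡ false
dichotomy true  = inj₁ refl
dichotomy false = inj₂ refl

does-true : ∀ {P : Set} (P? : Dec P) → does P? ≡ true → P
does-true (yes p) refl = p

does-false : ∀ {P : Set} (P? : Dec P) → does P? ≡ false → ¬ P
does-false (no ¬p) refl = ¬p

not-true : ∀ {b} → not b ≡ true → b ≡ false
not-true {false} refl = refl

-- Finite sets and their cardinalities

infixr 7 _∩_
infixl 7 _∖_
infix  4 _⊆_ _∋_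

-- Sets are Boolean predicates, so that membership is decidable and a cardinality is a sum of
-- indicators.
_∋_ : ∀ {A : Set} → (A → Bool) → A → Set
S ∋ x = S x ≡ true

_⊆_ : ∀ {A : Set} → (A → Bool) → (A → Bool) → Set
S ⊆ S′ = ∀ x → S ∋ x → S′ ∋ x

_∩_ : ∀ {A : Set} → (A → Bool) → (A → Bool) → A → Bool
(S ∩ S′) x = S x ∧ S′ x

_∖_ : ∀ {A : Set} → (A → Bool) → (A → Bool) → A → Bool
(S ∖ S′) x = S x ∧ not (S′ x)

full : ∀ {A : Set} → A → Bool
full _ = true

singleton : ∀ {n} → Fin n → Fin n → Bool
singleton x v = does (v Fin.≟ x)

∣_∣ : ∀ {n} → (Fin n → Bool) → ℕ
∣ S ∣ = ∑ (allFin _) (𝟙 ∘ S)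

∑-allFin-const : ∀ n c → ∑ (allFin n) (λ _ → c) ≡ n * c
∑-allFin-const n c = trans (∑-const (allFin n) c) (cong (_* c) (length-tabulate {n = n} (λ i → i)))

module _ {n : ℕ} where

  ∣∣-mono : {S S′ : Fin n → Bool} → S ⊆ S′ → ∣ S ∣ ≤ ∣ S′ ∣
  ∣∣-mono sub = ∑-mono (allFin n) (λ x → 𝟙-mono (sub x))

  ∣full∣ : ∣ full {Fin n} ∣ ≡ n
  ∣full∣ = trans (∑-allFin-const n 1) (*-identityʳ n)

  ∣∣≤n : (S : Fin n → Bool) → ∣ S ∣ ≤ n
  ∣∣≤n S = subst (∣ S ∣ ≤_) ∣full∣ (∣∣-mono {S} {full} (λ _ _ → refl))

  ∣∣-split : (S S′ : Fin n → Bool) → ∣ S ∣ ≡ ∣ S ∩ S′ ∣ + ∣ S ∖ S′ ∣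
  ∣∣-split S S′ = trans (∑-cong (allFin n) (λ x → pointwise (S x) (S′ x)))
                        (∑-+ (allFin n) (𝟙 ∘ (S ∩ S′)) (𝟙 ∘ (S ∖ S′)))
    where
    pointwise : ∀ a b → 𝟙 a ≡ 𝟙 (a ∧ b) + 𝟙 (a ∧ not b)
    pointwise false b     = refl
    pointwise true  true  = refl
    pointwise true  false = refl

  ∣∖∣-≤ : (S S′ : Fin n → Bool) → ∣ S ∣ ≤ ∣ S′ ∣ + ∣ S ∖ S′ ∣
  ∣∖∣-≤ S S′ = ≤-trans (≤-reflexive (∣∣-split S S′))
    (+-monoˡ-≤ _ (∣∣-mono {S ∩ S′} {S′} (λ x h → proj₂ (∧-true {S x} h))))

  ∣∣-pick : (S S′ : Fin n → Bool) → ∣ S ∣ < ∣ S′ ∣ → ∃[ x ] S′ ∋ x × S x ≡ false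
  ∣∣-pick S S′ lt with ∑-pick (allFin n) (𝟙 ∘ S) (𝟙 ∘ S′) lt
  ... | x , x-lt = x , pointwise (S x) (S′ x) x-lt
    where
    pointwise : ∀ a b → 𝟙 a < 𝟙 b → b ≡ true × a ≡ false
    pointwise false true  _        = refl , refl
    pointwise true  true  (s≤s ())

∣singleton∣ : ∀ {n} (x : Fin n) → ∣ singleton x ∣ ≡ 1
∣singleton∣ {suc n} x =
  trans (cong (λ l → 𝟙 (singleton x zero) + ∑ l (𝟙 ∘ singleton x)) (sym (map-tabulate (λ i → i) suc)))
        (trans (cong (𝟙 (singleton x zero) +_) (∑-map (allFin n) suc (𝟙 ∘ singleton x))) (rest x))
  where
  rest : ∀ x → 𝟙 (singleton x zero) + ∑ (allFin n) (𝟙 ∘ singleton x ∘ suc) ≡ 1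
  rest zero    = cong suc (∑-zero (allFin n))
  rest (suc x) = ∣singleton∣ x

module _ {n : ℕ} where

  remove-≤ : ∀ (S : Fin n → Bool) x → ∣ S ∣ ≤ suc ∣ S ∖ singleton x ∣
  remove-≤ S x = subst (λ k → ∣ S ∣ ≤ k + ∣ S ∖ singleton x ∣) (∣singleton∣ x) (∣∖∣-≤ S (singleton x))

  remove-≥ : ∀ (S : Fin n → Bool) x → S ∋ x → suc ∣ S ∖ singleton x ∣ ≤ ∣ S ∣
  remove-≥ S x Sx = begin
    1 + ∣ S ∖ singleton x ∣                      ≡⟨ cong (_+ ∣ S ∖ singleton x ∣) (∣singleton∣ x) ⟨
    ∣ singleton x ∣ + ∣ S ∖ singleton x ∣        ≤⟨ +-monoˡ-≤ _ (∣∣-mono {n} {singleton x} {S ∩ singleton x} sub) ⟩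
    ∣ S ∩ singleton x ∣ + ∣ S ∖ singleton x ∣    ≡⟨ ∣∣-split S (singleton x) ⟨
    ∣ S ∣                                        ∎
    where
    open ≤-Reasoning
    sub : singleton x ⊆ S ∩ singleton x
    sub v v≡x = true-∧ (subst (S ∋_) (sym (does-true (v Fin.≟ x) v≡x)) Sx) v≡x

  ∈-remove : ∀ {S : Fin n → Bool} {x y} → S ∋ y → y ≢ x → S ∖ singleton x ∋ y
  ∈-remove {x = x} {y} Sy y≢x = true-∧ Sy (cong not (dec-false (y Fin.≟ x) y≢x))

  ∉-remove : ∀ {S : Fin n → Bool} {x y} → S ∖ singleton x ∋ y → S ∋ y × y ≢ x
  ∉-remove {S} {x} {y} h with ∧-true {S y} h
  ... | Sy , ny = Sy , does-false (y Fin.≟ x) (not-true ny)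

  -- Pigeonhole, by deleting the listed elements from S one at a time.
  unique-length : ∀ (S : Fin n → Bool) {xs} → Unique xs → All (S ∋_) xs → length xs ≤ ∣ S ∣
  unique-length S []         []         = z≤n
  unique-length S {x ∷ xs} (x∉ ∷ uniq) (Sx ∷ Sxs) =
    ≤-trans (s≤s (unique-length (S ∖ singleton x) uniq
      (All.zipWith (λ (Sy , x≢y) → ∈-remove {S} Sy (x≢y ∘ sym)) (Sxs , x∉))))
      (remove-≥ S x Sx)

  -- Supplies the next vertex of a greedy embedding, `xs` being the vertices already used.
  avoid : ∀ (S : Fin n → Bool) xs → length xs < ∣ S ∣ → ∃[ v ] S ∋ v × v ∉ xs
  avoid S [] lt with ∣∣-pick (λ _ → false) S (subst (_< ∣ S ∣) (sym (∑-zero (allFin n))) lt)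
  ... | v , Sv , _ = v , Sv , λ ()
  avoid S (x ∷ xs) lt with avoid (S ∖ singleton x) xs (s≤s⁻¹ (≤-trans lt (remove-≤ S x)))
  ... | v , S∖v , v∉ with ∉-remove {S} S∖v
  ... | Sv , v≢x = v , Sv , λ { (here v≡x) → v≢x v≡x ; (there v∈) → v∉ v∈ }

-- Dense hypergraphs

tuples : ∀ k N → List (Vec (Fin N) k)
tuples zero    N = [] ∷ []
tuples (suc k) N = cartesianProductWith _∷_ (allFin N) (tuples k N)

-- Hypergraphs are predicates on ordered tuples, repetitions allowed: there are exactly N ^ k
-- tuples, and induction on k splits off the first coordinate.
# : ∀ {k N} → (Vec (Fin N) k → Bool) → ℕ
# {k} {N} E = ∑ (tuples k N) (𝟙 ∘ E)

#-suc : ∀ {k N} (E : Vec (Fin N) (suc k) → Bool) → # E ≡ ∑ (allFin N) (λ x → # (E ∘ (x ∷_)))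
#-suc {k} {N} E = ∑-product _∷_ (allFin N) (tuples k N) (𝟙 ∘ E)

#full : ∀ k N → # {k} {N} full ≡ N ^ k
#full zero    N = refl
#full (suc k) N = trans (#-suc {k} {N} full)
  (trans (∑-cong (allFin N) (λ _ → #full k N)) (∑-allFin-const N (N ^ k)))

positiveʳ : ∀ c {m} → 1 ≤ c * m → 1 ≤ m
positiveʳ c {zero}  h = ≤-trans h (≤-reflexive (*-zeroʳ c))
positiveʳ c {suc m} h = s≤s z≤n

-- `R` is a bipartite relation and `κ` an inverse density. In the application y runs over the
-- k-tuples, and `R x y` says that x ∷ y is an edge of a (k + 1)-uniform hypergraph.
module _ {N : ℕ} {A : Set} (ys : List A) (R : Fin N → A → Bool) (κ : ℕ) (κ>0 : 1 ≤ κ) where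

  private
    degree : (Fin N → Bool) → A → ℕ
    degree Z y = ∣ Z ∩ (λ x → R x y) ∣

    size : (A → Bool) → ℕ
    size Y = ∑ ys (𝟙 ∘ Y)

  -- Double counting of the related pairs in Z × Y: each y in Y accounts for more than N/κ of them,
  -- so some x accounts for more than a κ-th of Y.
  popular : (Z : Fin N → Bool) (Y : A → Bool) → 1 ≤ size Y →
            (∀ y → Y ∋ y → N < κ * degree Z y) →
            ∃[ x ] Z ∋ x × size Y ≤ κ * size (Y ∩ R x)
  popular Z Y Y>0 deg = found (∑-pick (allFin N) (λ _ → size Y) weight average)
    where
    open ≤-Reasoning
    -- Elements outside Z have weight 0, so an x of weight above `size Y` lies in Z.
    weight : Fin N → ℕ
    weight x = 𝟙 (Z x) * (κ * size (Y ∩ R x))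
    pointwise : ∀ y → 𝟙 (Y y) * suc N ≤ ∑ (allFin N) (λ x → 𝟙 (Z x) * (κ * 𝟙 ((Y ∩ R x) y)))
    pointwise y with Y y in Yy
    ... | false = z≤n
    ... | true  = begin
      1 * suc N                                       ≡⟨ *-identityˡ _ ⟩
      suc N                                           ≤⟨ deg y Yy ⟩
      κ * degree Z y                                  ≡⟨ ∑-*ˡ (allFin N) κ _ ⟨
      ∑ (allFin N) (λ x → κ * 𝟙 (Z x ∧ R x y))        ≡⟨ ∑-cong (allFin N) (λ x → rearrange (Z x) (R x y)) ⟩
      ∑ (allFin N) (λ x → 𝟙 (Z x) * (κ * 𝟙 (R x y)))  ∎
      where
      rearrange : ∀ a b → κ * 𝟙 (a ∧ b) ≡ 𝟙 a * (κ * 𝟙 b)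
      rearrange true  b = sym (*-identityˡ _)
      rearrange false b = *-zeroʳ κ
    average : ∑ (allFin N) (λ _ → size Y) < ∑ (allFin N) weight
    average = begin-strict
      ∑ (allFin N) (λ _ → size Y)        ≡⟨ ∑-allFin-const N (size Y) ⟩
      N * size Y                         ≡⟨ *-comm N _ ⟩
      size Y * N                         <⟨ *-monoʳ-< (size Y) {{>-nonZero Y>0}} (n<1+n N) ⟩
      size Y * suc N                     ≡⟨ ∑-*ʳ ys (suc N) (𝟙 ∘ Y) ⟨
      ∑ ys (λ y → 𝟙 (Y y) * suc N)       ≤⟨ ∑-mono ys pointwise ⟩
      ∑ ys (λ y → ∑ (allFin N) (λ x → 𝟙 (Z x) * (κ * 𝟙 ((Y ∩ R x) y))))
        ≡⟨ ∑-swap ys (allFin N) _ ⟩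
      ∑ (allFin N) (λ x → ∑ ys (λ y → 𝟙 (Z x) * (κ * 𝟙 ((Y ∩ R x) y))))
        ≡⟨ ∑-cong (allFin N) (λ x → trans (∑-*ˡ ys (𝟙 (Z x)) _) (cong (𝟙 (Z x) *_) (∑-*ˡ ys κ _))) ⟩
      ∑ (allFin N) weight                ∎
    found : ∃[ x ] size Y < weight x → ∃[ x ] Z ∋ x × size Y ≤ κ * size (Y ∩ R x)
    found (x , lt) with Z x in Zx
    ... | true  = x , Zx , ≤-trans (<⇒≤ lt) (≤-reflexive (*-identityˡ _))
    ... | false = ⊥-elim (n≮0 lt)

  -- Greedy choice: removing a chosen x from Z costs each y at most 1.
  common : ∀ M (Z : Fin N → Bool) (Y : A → Bool) → 1 ≤ size Y →
           (∀ y → Y ∋ y → N + M * κ ≤ κ * degree Z y) →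
           ∃[ X ] Injective _≡_ _≡_ X × (∀ (j : Fin M) → Z ∋ X j) ×
           ∃[ Y′ ] size Y ≤ κ ^ M * size Y′ ×
                   (∀ y → Y′ ∋ y → Y ∋ y × (∀ j → R (X j) y ≡ true))
  common zero Z Y Y>0 deg =
    (λ ()) , (λ { {()} }) , (λ ()) , Y , ≤-reflexive (sym (*-identityˡ _)) , λ _ Yy → Yy , λ ()
  common (suc M) Z Y Y>0 deg
    with popular Z Y Y>0 (λ y Yy → <-≤-trans (m<m+n N (≤-trans κ>0 (m≤m+n κ (M * κ)))) (deg y Yy))
  ... | x , Zx , Y≤ with common M (Z ∖ singleton x) (Y ∩ R x) Yx>0 deg′
    where
    open ≤-Reasoning
    Yx>0 : 1 ≤ size (Y ∩ R x)
    Yx>0 = positiveʳ κ (≤-trans Y>0 Y≤)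
    deg′ : ∀ y → Y ∩ R x ∋ y → N + M * κ ≤ κ * degree (Z ∖ singleton x) y
    deg′ y Yy = +-cancelˡ-≤ κ _ _ (begin
      κ + (N + M * κ)                     ≡⟨ shuffle κ N (M * κ) ⟩
      N + suc M * κ                       ≤⟨ deg y (proj₁ (∧-true {Y y} Yy)) ⟩
      κ * degree Z y                      ≤⟨ *-monoʳ-≤ κ (remove-≤ (Z ∩ (λ x → R x y)) x) ⟩
      κ * suc ∣ (Z ∩ (λ x → R x y)) ∖ singleton x ∣  ≡⟨ *-suc κ _ ⟩
      κ + κ * ∣ (Z ∩ (λ x → R x y)) ∖ singleton x ∣
        ≤⟨ +-monoʳ-≤ κ (*-monoʳ-≤ κ (∣∣-mono {N} {(Z ∩ (λ x → R x y)) ∖ singleton x} sub)) ⟩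
      κ + κ * degree (Z ∖ singleton x) y  ∎)
      where
      shuffle : ∀ a b c → a + (b + c) ≡ b + (a + c)
      shuffle = solve-∀
      sub : (Z ∩ (λ x → R x y)) ∖ singleton x ⊆ (Z ∖ singleton x) ∩ (λ x → R x y)
      sub v h with ∧-true {Z v ∧ R v y} h
      ... | ZR , v≢x with ∧-true {Z v} ZR
      ... | Zv , Rv = true-∧ (true-∧ Zv v≢x) Rv
  ... | X , X-inj , X⊆ , Y′ , large , related =
    x Func.∷ X , inj , X∈ , Y′ , large′ , related′
    where
    open ≤-Reasoning
    X∈Z∖x : ∀ j → Z ∋ X j × X j ≢ x
    X∈Z∖x j = ∉-remove {S = Z} (X⊆ j)
    inj : Injective _≡_ _≡_ (x Func.∷ X)
    inj {zero}  {zero}  eq = refl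
    inj {zero}  {suc j} eq = ⊥-elim (proj₂ (X∈Z∖x j) (sym eq))
    inj {suc i} {zero}  eq = ⊥-elim (proj₂ (X∈Z∖x i) eq)
    inj {suc i} {suc j} eq = cong suc (X-inj eq)
    X∈ : ∀ j → Z ∋ (x Func.∷ X) j
    X∈ zero    = Zx
    X∈ (suc j) = proj₁ (X∈Z∖x j)
    large′ : size Y ≤ κ ^ suc M * size Y′
    large′ = begin
      size Y                      ≤⟨ Y≤ ⟩
      κ * size (Y ∩ R x)          ≤⟨ *-monoʳ-≤ κ large ⟩
      κ * (κ ^ M * size Y′)       ≡⟨ *-assoc κ (κ ^ M) (size Y′) ⟨
      κ ^ suc M * size Y′         ∎
    related′ : ∀ y → Y′ ∋ y → Y ∋ y × (∀ j → R ((x Func.∷ X) j) y ≡ true)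
    related′ y Y′y with related y Y′y
    ... | YRy , RX with ∧-true {Y y} YRy
    ... | Yy , Rxy = Yy , λ { zero → Rxy ; (suc j) → RX j }

  -- Those y related to at least N/(2κ) of the x account for half of the pairs
  -- counted by the hypothesis.
  heavy : ∀ K → N * K ≤ κ * ∑ (allFin N) (λ x → size (R x)) → length ys ≤ K → 1 ≤ N →
          K ≤ 2 * κ * size (λ y → does (N ≤? 2 * κ * degree full y))
  heavy K dense len N>0 = *-cancelˡ-≤ N {{>-nonZero N>0}} (+-cancelˡ-≤ (N * K) _ _ (begin
    N * K + N * K                                 ≤⟨ +-mono-≤ dense dense ⟩
    κ * pairs + κ * pairs                         ≡⟨ double κ pairs ⟩
    2 * κ * pairs                                 ≡⟨ cong (2 * κ *_) (∑-swap (allFin N) ys _) ⟩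
    2 * κ * ∑ ys (degree full)                    ≡⟨ ∑-*ˡ ys (2 * κ) _ ⟨
    ∑ ys (λ y → 2 * κ * degree full y)            ≤⟨ ∑-mono ys pointwise ⟩
    ∑ ys (λ y → N + 2 * κ * N * 𝟙 (H y))          ≡⟨ ∑-+ ys (λ _ → N) _ ⟩
    ∑ ys (λ _ → N) + ∑ ys (λ y → 2 * κ * N * 𝟙 (H y))
      ≡⟨ cong₂ _+_ (trans (∑-const ys N) (*-comm (length ys) N)) (∑-*ˡ ys (2 * κ * N) _) ⟩
    N * length ys + 2 * κ * N * size H            ≤⟨ +-monoˡ-≤ _ (*-monoʳ-≤ N len) ⟩
    N * K + 2 * κ * N * size H                    ≡⟨ cong (N * K +_) (rotate (2 * κ) N (size H)) ⟩
    N * K + N * (2 * κ * size H)                  ∎))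
    where
    open ≤-Reasoning
    pairs = ∑ (allFin N) (λ x → size (R x))
    H : A → Bool
    H y = does (N ≤? 2 * κ * degree full y)
    double : ∀ a b → a * b + a * b ≡ 2 * a * b
    double = solve-∀
    rotate : ∀ a b c → a * b * c ≡ b * (a * c)
    rotate = solve-∀
    pointwise : ∀ y → 2 * κ * degree full y ≤ N + 2 * κ * N * 𝟙 (H y)
    pointwise y with H y in Hy
    ... | true  = ≤-trans (*-monoʳ-≤ (2 * κ) (∣∣≤n (λ x → R x y)))
                      (≤-trans (≤-reflexive (sym (*-identityʳ _))) (m≤n+m _ N))
    ... | false = ≤-trans (<⇒≤ (≰⇒> (does-false (N ≤? 2 * κ * degree full y) Hy))) (m≤m+n N _)

-- Different parts may overlap here; for the clique hypergraph, adjacency of vertices from different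
-- parts keeps them disjoint.
Blown-up : ∀ {k N} → ℕ → (Vec (Fin N) k → Bool) → Set
Blown-up {k} {N} M E =
  Σ[ X ∈ (Fin k → Fin M → Fin N) ] (∀ i → Injective _≡_ _≡_ (X i)) ×
    (∀ (c : Fin k → Fin M) → E ∋ Vec.tabulate (λ i → X i (c i)))

-- Erdős's theorem on complete k-partite subhypergraphs of dense hypergraphs.
dense⇒blown-up : ∀ k κ M → 1 ≤ κ → ∃[ N₀ ] ∀ N → N₀ ≤ N → 1 ≤ N → (E : Vec (Fin N) k → Bool) →
                 N ^ k ≤ κ * # E → Blown-up M E
dense⇒blown-up zero κ M κ>0 = 0 , λ N _ _ E dense → (λ ()) , (λ ()) , λ _ → holds (E []) dense
  where
  holds : ∀ b → 1 ≤ κ * (𝟙 b + 0) → b ≡ true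
  holds true  _ = refl
  holds false h = ⊥-elim (1+n≰n (≤-trans h (≤-reflexive (*-zeroʳ κ))))
-- The heavy k-tuples have inverse density 2 * κ, and each of the M common first coordinates costs a
-- further factor 4 * κ.
dense⇒blown-up (suc k) κ M κ>0 with dense⇒blown-up k (2 * κ * (4 * κ) ^ M) M (1≤κ′)
  where
  1≤κ′ : 1 ≤ 2 * κ * (4 * κ) ^ M
  1≤κ′ = *-mono-≤ (≤-trans κ>0 (m≤m+n κ _)) (m^n>0 (4 * κ) {{>-nonZero (≤-trans κ>0 (m≤m+n κ _))}} M)
... | N₁ , blow = N₁ + M * (4 * κ) , λ N N≥ N>0 E dense → main N N≥ N>0 E dense
  where
  main : ∀ N → N₁ + M * (4 * κ) ≤ N → 1 ≤ N → (E : Vec (Fin N) (suc k) → Bool) →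
         N ^ suc k ≤ κ * # E → Blown-up M E
  main N N≥ N>0 E dense =
    extend (common ys R (4 * κ) 4κ>0 M full H H>0 degH)
    where
    open ≤-Reasoning
    ys = tuples k N
    R : Fin N → Vec (Fin N) k → Bool
    R x y = E (x ∷ y)
    4κ>0 : 1 ≤ 4 * κ
    4κ>0 = ≤-trans κ>0 (m≤m+n κ _)
    H : Vec (Fin N) k → Bool
    H y = does (N ≤? 2 * κ * ∣ full ∩ (λ x → R x y) ∣)
    length-ys : length ys ≡ N ^ k
    length-ys = trans (sym (*-identityʳ _)) (trans (sym (∑-const ys 1)) (#full k N))
    H-large : N ^ k ≤ 2 * κ * # H
    H-large = heavy ys R κ κ>0 (N ^ k)
      (≤-trans dense (≤-reflexive (cong (κ *_) (#-suc E)))) (≤-reflexive length-ys) N>0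
    H>0 : 1 ≤ # H
    H>0 = positiveʳ (2 * κ) (≤-trans (m^n>0 N {{>-nonZero N>0}} k) H-large)
    -- A heavy y has degree at least N/(2κ). Passing from 2 * κ to 4 * κ doubles the left side to N
    -- + N, which leaves room for M removals once N ≥ M * (4 * κ).
    degH : ∀ y → H ∋ y → N + M * (4 * κ) ≤ 4 * κ * ∣ full ∩ (λ x → R x y) ∣
    degH y Hy = begin
      N + M * (4 * κ)                                ≤⟨ +-monoʳ-≤ N (≤-trans (m≤n+m _ N₁) N≥) ⟩
      N + N                                          ≤⟨ +-mono-≤ N≤ N≤ ⟩
      2 * κ * d + 2 * κ * d                          ≡⟨ double κ d ⟩
      4 * κ * d                                      ∎
      where
      d = ∣ full ∩ (λ x → R x y) ∣
      N≤ : N ≤ 2 * κ * d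
      N≤ = does-true (N ≤? 2 * κ * d) Hy
      double : ∀ a b → 2 * a * b + 2 * a * b ≡ 4 * a * b
      double = solve-∀
    extend : ∃[ X ] Injective _≡_ _≡_ X × (∀ (j : Fin M) → full ∋ X j) ×
             ∃[ Y′ ] # H ≤ (4 * κ) ^ M * # Y′ × (∀ y → Y′ ∋ y → H ∋ y × (∀ j → R (X j) y ≡ true)) →
             Blown-up M E
    extend (X₀ , X₀-inj , _ , Y′ , large , related)
      with blow N (≤-trans (m≤m+n N₁ _) N≥) N>0 Y′ (begin
        N ^ k                                 ≤⟨ H-large ⟩
        2 * κ * # H                           ≤⟨ *-monoʳ-≤ (2 * κ) large ⟩
        2 * κ * ((4 * κ) ^ M * # Y′)          ≡⟨ *-assoc (2 * κ) _ _ ⟨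
        2 * κ * (4 * κ) ^ M * # Y′            ∎)
    ... | X , X-inj , complete =
      X₀ Func.∷ X , (λ { zero → X₀-inj ; (suc i) → X-inj i }) ,
      λ c → proj₂ (related _ (complete (c ∘ suc))) (c zero)

-- Counting cliques

module _ {N : ℕ} (B : Graph (Fin N)) where

  -- Cliques are ordered tuples, and S shrinks to the neighbourhood of each chosen vertex, so that
  -- counting by the first vertex is immediate.
  clique : ∀ {k} → (Fin N → Bool) → Vec (Fin N) k → Bool
  clique S []       = true
  clique S (x ∷ xs) = S x ∧ clique (S ∩ adj B x) xs

  cliques : ℕ → (Fin N → Bool) → ℕ
  cliques k S = # {k} (clique S)

  -- Source of the lower bounds on clique counts of positive order: L collects good first vertices.
  cliques-suc : ∀ k S L m → L ⊆ S → (∀ v → L ∋ v → m ≤ cliques k (S ∩ adj B v)) →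
                ∣ L ∣ * m ≤ cliques (suc k) S
  cliques-suc k S L m L⊆S many = begin
    ∣ L ∣ * m                                                    ≡⟨ ∑-*ʳ (allFin N) m (𝟙 ∘ L) ⟨
    ∑ (allFin N) (λ x → 𝟙 (L x) * m)                             ≤⟨ ∑-mono (allFin N) pointwise ⟩
    ∑ (allFin N) (λ x → # {k} (λ xs → clique S (x ∷ xs)))        ≡⟨ #-suc {k} (clique S) ⟨
    cliques (suc k) S                                            ∎
    where
    open ≤-Reasoning
    pointwise : ∀ x → 𝟙 (L x) * m ≤ # {k} (λ xs → clique S (x ∷ xs))
    pointwise x with L x in Lx
    ... | false = z≤n
    ... | true rewrite L⊆S x Lx = ≤-trans (≤-reflexive (*-identityˡ m)) (many x Lx)

  cliques-1 : ∀ S → ∣ S ∣ ≤ cliques 1 S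
  cliques-1 S = ≤-trans (≤-reflexive (sym (*-identityʳ _))) (cliques-suc 0 S S 1 (λ _ h → h) (λ _ _ → ≤-refl))

  clique-mono : ∀ {k S S′} → S ⊆ S′ → clique {k} S ⊆ clique S′
  clique-mono sub []       h = refl
  clique-mono {S = S} {S′} sub (x ∷ xs) h with ∧-true {S x} h
  ... | Sx , rest = true-∧ (sub x Sx) (clique-mono restrict xs rest)
    where
    restrict : S ∩ adj B x ⊆ S′ ∩ adj B x
    restrict v h with ∧-true {S v} h
    ... | Sv , xv = true-∧ (sub v Sv) xv

  cliques-mono : ∀ k {S S′} → S ⊆ S′ → cliques k S ≤ cliques k S′
  cliques-mono k sub = ∑-mono (tuples k N) (λ xs → 𝟙-mono (clique-mono {k} sub xs))

  clique⇒∈ : ∀ {k S} (xs : Vec (Fin N) k) → clique S ∋ xs → ∀ i → S ∋ Vec.lookup xs i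
  clique⇒∈ {S = S} (x ∷ xs) h i with ∧-true {S x} h
  clique⇒∈         (x ∷ xs) h zero    | Sx , rest = Sx
  clique⇒∈ {S = S} (x ∷ xs) h (suc i) | Sx , rest = proj₁ (∧-true {S (Vec.lookup xs i)} (clique⇒∈ xs rest i))

  clique⇒edge : ∀ {k S} (xs : Vec (Fin N) k) → clique S ∋ xs → ∀ i j → i ≢ j →
                Edge B (Vec.lookup xs i) (Vec.lookup xs j)
  clique⇒edge {S = S} (x ∷ xs) h i j i≢j with ∧-true {S x} h
  clique⇒edge         (x ∷ xs) h zero    zero    i≢j | Sx , rest = ⊥-elim (i≢j refl)
  clique⇒edge {S = S} (x ∷ xs) h zero    (suc j) i≢j | Sx , rest = proj₂ (∧-true {S (Vec.lookup xs j)} (clique⇒∈ xs rest j))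
  clique⇒edge {S = S} (x ∷ xs) h (suc i) zero    i≢j | Sx , rest =
    trans (adj-sym B (Vec.lookup xs i) x) (proj₂ (∧-true {S (Vec.lookup xs i)} (clique⇒∈ xs rest i)))
  clique⇒edge         (x ∷ xs) h (suc i) (suc j) i≢j | Sx , rest =
    clique⇒edge xs rest i j (i≢j ∘ cong suc)

  -- Every transversal of the blow-up is a clique, so vertices of different parts are adjacent and
  -- in particular distinct; each part is then cut down to its first m i vertices.
  blown-up-clique⇒K : ∀ {k} (m : Fin k → ℕ) M → (∀ i → m i ≤ M) →
                      Blown-up {k} M (clique full) → Contains B (K m)
  blown-up-clique⇒K {k} m M m≤M (X , X-inj , complete) = f , f-inj , f-edge
    where
    f : Σ[ i ∈ Fin k ] Fin (m i) → Fin N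
    f (i , j) = X i (Fin.inject≤ j (m≤M i))
    cross : ∀ i j i′ j′ → i ≢ i′ → Edge B (X i j) (X i′ j′)
    cross i j i′ j′ i≢i′ =
      subst₂ (Edge B) (trans (Vec.lookup∘tabulate g i) (cong (X i) at-i))
                      (trans (Vec.lookup∘tabulate g i′) (cong (X i′) at-i′))
             (clique⇒edge {S = full} (Vec.tabulate g) (complete c) i i′ i≢i′)
      where
      -- A transversal through both given vertices: index j in part i, index j′ in every other part.
      c : Fin k → Fin M
      c l with l Fin.≟ i
      ... | yes _ = j
      ... | no  _ = j′
      g : Fin k → Fin N
      g l = X l (c l)
      at-i : c i ≡ j
      at-i with i Fin.≟ i
      ... | yes _   = refl
      ... | no  i≢i = ⊥-elim (i≢i refl)
      at-i′ : c i′ ≡ j′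
      at-i′ with i′ Fin.≟ i
      ... | yes eq = ⊥-elim (i≢i′ (sym eq))
      ... | no  _  = refl
    f-inj : Injective _≡_ _≡_ f
    f-inj {i , j} {i′ , j′} eq with i Fin.≟ i′
    ... | yes refl = cong (i ,_) (Fin.inject≤-injective (m≤M i) (m≤M i) j j′ (X-inj i eq))
    ... | no  i≢i′ = ⊥-elim (true≢false (cross i _ i′ _ i≢i′)
                       (subst (λ v → adj B (f (i , j)) v ≡ false) eq (adj-irrefl B (f (i , j)))))
    f-edge : ∀ {u v} → Edge (K m) u v → Edge B (f u) (f v)
    f-edge {i , j} {i′ , j′} e = cross i _ i′ _ (does-false (i Fin.≟ i′) (not-true e))

abstract
  -- Supersaturation: a positive proportion of cliques among the k-tuples would yield a blown-up
  -- clique, hence a copy of `K m`.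
  few-cliques : ∀ k (m : Fin k → ℕ) M → (∀ i → m i ≤ M) → ∀ κ → 1 ≤ κ →
                ∃[ N₀ ] ∀ N → N₀ ≤ N → 1 ≤ N → (B : Graph (Fin N)) → ¬ Contains B (K m) →
                ∀ S → κ * cliques B k S < N ^ k
  few-cliques k m M m≤M κ κ>0 with dense⇒blown-up k κ M κ>0
  ... | N₀ , blow = N₀ , λ N N≥ N>0 B K⊈B S → ≰⇒> λ dense →
    K⊈B (blown-up-clique⇒K B m M m≤M (blow N N≥ N>0 (clique B full)
      (≤-trans dense (*-monoʳ-≤ κ (cliques-mono B k (λ _ _ → refl))))))

-- Trees

lookup-injective : ∀ {A : Set} {xs : List A} → Unique xs → ∀ i j → lookup xs i ≡ lookup xs j → i ≡ j
lookup-injective (_  ∷ _)    zero    zero    eq = refl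
lookup-injective (x∉ ∷ _)    zero    (suc j) eq = ⊥-elim (All.lookup x∉ (∈-lookup j) eq)
lookup-injective (x∉ ∷ _)    (suc i) zero    eq = ⊥-elim (All.lookup x∉ (∈-lookup i) (sym eq))
lookup-injective (_  ∷ uniq) (suc i) (suc j) eq = cong suc (lookup-injective uniq i j eq)

infixr 6 _∪_
_∪_ : ∀ {A : Set} → (A → Bool) → (A → Bool) → A → Bool
(S ∪ S′) x = S x ∨ S′ x

∪⁻ : ∀ {A : Set} (S S′ : A → Bool) {x} → S ∪ S′ ∋ x → S ∋ x ⊎ S′ ∋ x
∪⁻ S S′ {x} h with S x
... | true  = inj₁ refl
... | false = inj₂ h

∪⁺ˡ : ∀ {A : Set} (S S′ : A → Bool) {x} → S ∋ x → S ∪ S′ ∋ x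
∪⁺ˡ S S′ Sx rewrite Sx = refl

∪⁺ʳ : ∀ {A : Set} (S S′ : A → Bool) {x} → S′ ∋ x → S ∪ S′ ∋ x
∪⁺ʳ S S′ {x} S′x rewrite S′x = ∨-zeroʳ (S x)

∣∪∣-≤ : ∀ {n} (S S′ : Fin n → Bool) → ∣ S ∪ S′ ∣ ≤ ∣ S ∣ + ∣ S′ ∣
∣∪∣-≤ {n} S S′ = ≤-trans (∑-mono (allFin n) (λ x → pointwise (S x) (S′ x))) (≤-reflexive (∑-+ (allFin n) _ _))
  where
  pointwise : ∀ a b → 𝟙 (a ∨ b) ≤ 𝟙 a + 𝟙 b
  pointwise true  b = s≤s z≤n
  pointwise false b = ≤-refl

∈-singleton : ∀ {n} (x : Fin n) → singleton x ∋ x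
∈-singleton x = dec-true (x Fin.≟ x) refl

module _ {n : ℕ} (T : Graph (Fin n)) where

  open import Data.List.Membership.DecPropositional (Fin._≟_ {n}) using (_∈?_)

  Edge-sym : ∀ {u v} → Edge T u v → Edge T v u
  Edge-sym {u} {v} = trans (adj-sym T v u)

  data Path : Fin n → Fin n → List (Fin n) → Set where
    stop : ∀ {x} → Path x x (x ∷ [])
    step : ∀ {x y z vs} → Edge T x y → Path y z vs → Path x z (x ∷ vs)

  Path-snoc : ∀ {x y z vs} → Path x y vs → Edge T y z → Path x z (vs ∷ʳ z)
  Path-snoc stop       yz = step yz stop
  Path-snoc (step e p) yz = step e (Path-snoc p yz)

  -- Orders in which T grows from the root w; that the parent p of v is its only
  -- earlier neighbour is where acyclicity is stored.
  data Grown (w : Fin n) : List (Fin n) → Set where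
    root : Grown w (w ∷ [])
    grow : ∀ {l v} p → Grown w l → v ∉ l → p ∈ l → Edge T p v →
           (∀ {x} → x ∈ l → Edge T x v → x ≡ p) → Grown w (v ∷ l)

  private
    all-∉ : ∀ {v : Fin n} {l} → v ∉ l → All (λ x → v ≢ x) l
    all-∉ = All.¬Any⇒All¬ _

  Grown-unique : ∀ {w l} → Grown w l → Unique l
  Grown-unique root               = [] ∷ []
  Grown-unique (grow p g v∉ _ _ _) = all-∉ v∉ ∷ Grown-unique g

  root∈ : ∀ {w l} → Grown w l → w ∈ l
  root∈ root               = here refl
  root∈ (grow _ g _ _ _ _) = there (root∈ g)

  -- The latest vertex hangs on p by an edge, so a path to it is a path to p prolonged; vertices
  -- stay distinct because it is new. Such paths are what an edge back into l would close to a
  -- cycle.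
  Grown-path : ∀ {w l} → Grown w l → ∀ {x y} → x ∈ l → y ∈ l →
               ∃[ vs ] Path x y vs × Unique vs × All (_∈ l) vs
  Grown-path root (here refl) (here refl) = _ , stop , [] ∷ [] , here refl ∷ []
  Grown-path (grow p g v∉ p∈ e _) (here refl) (here refl) = _ , stop , [] ∷ [] , here refl ∷ []
  Grown-path (grow p g v∉ p∈ e _) (here refl) (there y∈) with Grown-path g p∈ y∈
  ... | vs , path , uniq , vs⊆ =
    _ , step (Edge-sym e) path , All.map (λ z∈ v≡z → v∉ (subst (_∈ _) (sym v≡z) z∈)) vs⊆ ∷ uniq ,
    here refl ∷ All.map there vs⊆
  Grown-path (grow {v = v} p g v∉ p∈ e _) (there x∈) (here refl) with Grown-path g x∈ p∈
  ... | vs , path , uniq , vs⊆ =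
    _ , Path-snoc path e ,
    Unique.++⁺ uniq ([] ∷ []) (λ { (z∈ , here refl) → v∉ (All.lookup vs⊆ z∈) }) ,
    All.++⁺ (All.map there vs⊆) (here refl ∷ [])
  Grown-path (grow p g v∉ p∈ e _) (there x∈) (there y∈) with Grown-path g x∈ y∈
  ... | vs , path , uniq , vs⊆ = vs , path , uniq , All.map there vs⊆

  Path-edges : ∀ {x y z zs} → Path x y (z ∷ zs) → ∀ (i : Fin (length zs)) →
               Edge T (lookup (z ∷ zs) (inject₁ i)) (lookup zs i)
  Path-edges (step e stop)       zero    = e
  Path-edges (step e (step _ _)) zero    = e
  Path-edges (step e p@(step _ _)) (suc i) = Path-edges p i

  Path-last : ∀ {x y z zs} → Path x y (z ∷ zs) → lookup (z ∷ zs) (fromℕ (length zs)) ≡ y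
  Path-last stop                 = refl
  Path-last (step e stop)        = refl
  Path-last (step e p@(step _ _)) = Path-last p

  -- x ≢ y excludes the path with one vertex, so that together with v there are at least three.
  closed-path⇒Cycle : ∀ {v x y vs} → Path x y vs → Unique vs → v ∉ vs → x ≢ y →
                      Edge T v x → Edge T y v → Cycle T
  closed-path⇒Cycle stop uniq v∉ x≢y vx yv = ⊥-elim (x≢y refl)
  closed-path⇒Cycle {v} {x} path@(step {vs = z ∷ zs} _ _) uniq v∉ x≢y vx yv =
    length zs , lookup (v ∷ x ∷ z ∷ zs) , (λ {i} {j} → lookup-injective (all-∉ v∉ ∷ uniq) i j) ,
    Path-edges (step vx path) ,
    subst (λ u → Edge T u v) (sym (Path-last path)) yv

  module _ (acyclic : ¬ Cycle T) where

    unique-parent : ∀ {w l v} → Grown w l → v ∉ l → ∀ {x p} → x ∈ l → p ∈ l →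
                    Edge T x v → Edge T p v → x ≡ p
    unique-parent g v∉ {x} {p} x∈ p∈ xv pv with x Fin.≟ p
    ... | yes x≡p = x≡p
    ... | no  x≢p with Grown-path g x∈ p∈
    ... | vs , path , uniq , vs⊆ = ⊥-elim (acyclic
      (closed-path⇒Cycle path uniq (λ v∈ → v∉ (All.lookup vs⊆ v∈)) x≢p (Edge-sym xv) pv))

    exit : ∀ {x y} → Star (Edge T) x y → ∀ l → x ∈ l → y ∉ l → ∃[ p ] ∃[ v ] p ∈ l × v ∉ l × Edge T p v
    exit ε              l x∈ y∉ = ⊥-elim (y∉ x∈)
    exit (_◅_ {x} {z} e path) l x∈ y∉ with z ∈? l
    ... | yes z∈ = exit path l z∈ y∉
    ... | no  z∉ = x , z , x∈ , z∉ , e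

    -- While a vertex is missing, a walk from w to it leaves l along some edge, and the far end of
    -- that edge is the next vertex; acyclicity makes its parent unique.
    spanning : (∀ u v → Star (Edge T) u v) → ∀ w → ∃[ l ] Grown w l × (∀ v → v ∈ l)
    spanning conn w = extend n (w ∷ []) root (m<m+n n (s≤s z≤n))
      where
      -- By the invariant, fuel could run out only with more than n distinct vertices in l.
      extend : ∀ fuel l → Grown w l → n < fuel + length l → ∃[ l ] Grown w l × (∀ v → v ∈ l)
      extend fuel l g enough with Fin.all? (_∈? l)
      ... | yes all∈ = l , g , all∈
      extend zero l g enough | no _ = ⊥-elim (<⇒≱ enough
        (≤-trans (unique-length full (Grown-unique g) (All.tabulate (λ _ → refl))) (≤-reflexive ∣full∣)))
      extend (suc fuel) l g enough | no ¬all with Fin.¬∀⟶∃¬ n (_∈ l) (_∈? l) ¬all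
      ... | y , y∉ with exit (conn w y) l (root∈ g) y∉
      ... | p , v , p∈ , v∉ , e = extend fuel (v ∷ l)
        (grow p g v∉ p∈ e (λ x∈ xv → unique-parent g v∉ x∈ p∈ xv e))
        (≤-trans enough (≤-reflexive (sym (+-suc fuel (length l)))))

  -- X is a union of components of T - w.
  Branches : (Fin n → Bool) → Fin n → Set
  Branches X w = X w ≡ false × (∀ {x y} → X ∋ x → Edge T x y → X ∋ y ⊎ y ≡ w)

  module _ (s : ℕ) (s<n : s < n) where

    Split : Set
    Split = ∃[ X ] ∃[ w ] Branches X w × s ≤ ∣ X ∣ × ∣ X ∣ ≤ 2 * s

    -- Prune the leaves in reverse order of growth, hanging each on its parent:
    -- bag x collects what has been hung on x, and the first bag to reach size s
    -- has been assembled from two smaller ones and a vertex.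
    prune : ∀ {w l} → Grown w l → (bag : Fin n → Fin n → Bool) →
            (∀ {x y} → x ∈ l → bag x ∋ y → y ∉ l) →
            (∀ {x y z} → x ∈ l → bag x ∋ y → Edge T y z → bag x ∋ z ⊎ z ≡ x) →
            (∀ {y} → y ∉ l → ∃[ x ] x ∈ l × bag x ∋ y) →
            (∀ {x} → x ∈ l → ∣ bag x ∣ < s) →
            Split
    -- If no bag ever reaches size s, the bag of the root ends up with all other vertices,
    -- contradicting s < n.
    prune {w} root bag disj closed cover small = ⊥-elim (<⇒≱ s<n (begin
      n                            ≡⟨ ∣full∣ ⟨
      ∣ full {Fin n} ∣             ≤⟨ remove-≤ full w ⟩
      suc ∣ full ∖ singleton w ∣   ≤⟨ s≤s (∣∣-mono {n} {full ∖ singleton w} {bag w} covered) ⟩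
      suc ∣ bag w ∣                ≤⟨ small (here refl) ⟩
      s                            ∎))
      where
      open ≤-Reasoning
      covered : full ∖ singleton w ⊆ bag w
      covered y h with cover {y} (λ { (here y≡w) → proj₂ (∉-remove {S = full} h) y≡w })
      ... | x , here refl , y∈ = y∈
    prune {l = v ∷ l} (grow p g v∉ p∈ e parent) bag disj closed cover small = decide (s ≤? ∣ Q ∣)
      where
      open ≤-Reasoning
      Q : Fin n → Bool
      Q = bag p ∪ bag v ∪ singleton v
      Q⁻ : ∀ {y} → Q ∋ y → bag p ∋ y ⊎ bag v ∋ y ⊎ y ≡ v
      Q⁻ {y} h with ∪⁻ (bag p) (bag v ∪ singleton v) h
      ... | inj₁ y∈ = inj₁ y∈
      ... | inj₂ h′ with ∪⁻ (bag v) (singleton v) h′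
      ... | inj₁ y∈ = inj₂ (inj₁ y∈)
      ... | inj₂ y∈ = inj₂ (inj₂ (does-true (y Fin.≟ v) y∈))
      Q⁺ₚ : ∀ {y} → bag p ∋ y → Q ∋ y
      Q⁺ₚ = ∪⁺ˡ (bag p) (bag v ∪ singleton v)
      Q⁺ᵥ : ∀ {y} → bag v ∋ y → Q ∋ y
      Q⁺ᵥ {y} h = ∪⁺ʳ (bag p) (bag v ∪ singleton v) {y} (∪⁺ˡ (bag v) (singleton v) h)
      v∈Q : Q ∋ v
      v∈Q = ∪⁺ʳ (bag p) (bag v ∪ singleton v) {v} (∪⁺ʳ (bag v) (singleton v) {v} (∈-singleton v))
      Q-avoids : ∀ {y} → Q ∋ y → y ∉ l
      Q-avoids h y∈l with Q⁻ h
      ... | inj₁ y∈p         = disj (there p∈) y∈p (there y∈l)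
      ... | inj₂ (inj₁ y∈v)  = disj (here refl) y∈v (there y∈l)
      ... | inj₂ (inj₂ refl) = v∉ y∈l
      -- A neighbour of v still in l is its parent p. A pruned neighbour lies in a bag whose only
      -- neighbour outside is its owner, so that owner is v.
      v-edge : ∀ {z} → Edge T v z → Dec (z ∈ v ∷ l) → Q ∋ z ⊎ z ≡ p
      v-edge vz (yes (here refl)) = inj₁ v∈Q
      v-edge vz (yes (there z∈))  = inj₂ (parent z∈ (Edge-sym vz))
      v-edge vz (no z∉) with cover z∉
      ... | x , x∈ , z∈x with closed x∈ z∈x (Edge-sym vz)
      ... | inj₁ v∈x  = ⊥-elim (disj x∈ v∈x (here refl))
      ... | inj₂ refl = inj₁ (Q⁺ᵥ z∈x)
      Q-closed : ∀ {y z} → Q ∋ y → Edge T y z → Q ∋ z ⊎ z ≡ p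
      Q-closed h yz with Q⁻ h
      Q-closed h yz | inj₁ y∈p with closed (there p∈) y∈p yz
      ... | inj₁ z∈p = inj₁ (Q⁺ₚ z∈p)
      ... | inj₂ z≡p = inj₂ z≡p
      Q-closed h yz | inj₂ (inj₁ y∈v) with closed (here refl) y∈v yz
      ... | inj₁ z∈v  = inj₁ (Q⁺ᵥ z∈v)
      ... | inj₂ refl = inj₁ v∈Q
      Q-closed {z = z} h yz | inj₂ (inj₂ refl) = v-edge yz (z ∈? v ∷ l)
      Q≤2s : ∣ Q ∣ ≤ 2 * s
      Q≤2s = begin
        ∣ Q ∣                                         ≤⟨ ∣∪∣-≤ (bag p) (bag v ∪ singleton v) ⟩
        ∣ bag p ∣ + ∣ bag v ∪ singleton v ∣           ≤⟨ +-monoʳ-≤ ∣ bag p ∣ (∣∪∣-≤ (bag v) (singleton v)) ⟩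
        ∣ bag p ∣ + (∣ bag v ∣ + ∣ singleton v ∣)     ≡⟨ cong (λ k → ∣ bag p ∣ + (∣ bag v ∣ + k)) (∣singleton∣ v) ⟩
        ∣ bag p ∣ + (∣ bag v ∣ + 1)                   ≡⟨ cong (∣ bag p ∣ +_) (+-comm ∣ bag v ∣ 1) ⟩
        ∣ bag p ∣ + suc ∣ bag v ∣                     ≤⟨ +-mono-≤ (<⇒≤ (small (there p∈))) (small (here refl)) ⟩
        s + s                                         ≡⟨ cong (s +_) (+-identityʳ s) ⟨
        2 * s                                         ∎
      bag′ : Fin n → Fin n → Bool
      bag′ x = if does (x Fin.≟ p) then Q else bag x
      bag′-cases : ∀ x → (x ≡ p × bag′ x ≡ Q) ⊎ bag′ x ≡ bag x
      bag′-cases x with x Fin.≟ p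
      ... | yes x≡p = inj₁ (x≡p , refl)
      ... | no  _   = inj₂ refl
      bag′-p : bag′ p ≡ Q
      bag′-p rewrite dec-true (p Fin.≟ p) refl = refl
      disj′ : ∀ {x y} → x ∈ l → bag′ x ∋ y → y ∉ l
      disj′ {x} x∈ h y∈ with bag′ x | bag′-cases x
      ... | _ | inj₁ (_ , refl) = Q-avoids h y∈
      ... | _ | inj₂ refl       = disj (there x∈) h (there y∈)
      closed′ : ∀ {x y z} → x ∈ l → bag′ x ∋ y → Edge T y z → bag′ x ∋ z ⊎ z ≡ x
      closed′ {x} x∈ h yz with bag′ x | bag′-cases x
      ... | _ | inj₁ (refl , refl) = Q-closed h yz
      ... | _ | inj₂ refl          = closed (there x∈) h yz
      in-p : ∀ {y} → Q ∋ y → ∃[ x ] x ∈ l × bag′ x ∋ y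
      in-p {y} h = p , p∈ , subst (_∋ y) (sym bag′-p) h
      in-x : ∀ {x y} → x ∈ l → bag x ∋ y → ∃[ x ] x ∈ l × bag′ x ∋ y
      in-x {x} {y} x∈ h with bag′-cases x
      ... | inj₁ (refl , _) = in-p (Q⁺ₚ h)
      ... | inj₂ eq         = x , x∈ , subst (_∋ y) (sym eq) h
      cover′ : ∀ {y} → y ∉ l → ∃[ x ] x ∈ l × bag′ x ∋ y
      cover′ {y} y∉ with y Fin.≟ v
      ... | yes refl = in-p v∈Q
      ... | no  y≢v with cover {y} (λ { (here y≡v) → y≢v y≡v ; (there y∈) → y∉ y∈ })
      ... | x , here refl , h = in-p (Q⁺ᵥ h)
      ... | x , there x∈  , h = in-x x∈ h
      decide : Dec (s ≤ ∣ Q ∣) → Split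
      decide (yes s≤Q) = Q , p , (p∉Q , Q-closed) , s≤Q , Q≤2s
        where
        p∉Q : Q p ≡ false
        p∉Q with dichotomy (Q p)
        ... | inj₁ p∈Q = ⊥-elim (Q-avoids p∈Q p∈)
        ... | inj₂ eq  = eq
      decide (no s≰Q) = prune g bag′ disj′ closed′ cover′ small′
        where
        small′ : ∀ {x} → x ∈ l → ∣ bag′ x ∣ < s
        small′ {x} x∈ with bag′ x | bag′-cases x
        ... | _ | inj₁ (_ , refl) = ≰⇒> s≰Q
        ... | _ | inj₂ refl       = small (there x∈)

    split : IsTree T → 1 ≤ s → Split
    split ((w , conn) , acyclic) s>0 with spanning acyclic conn w
    ... | l , g , all∈ = prune g (λ _ _ → false) (λ _ ()) (λ _ ()) (λ {y} y∉ → ⊥-elim (y∉ (all∈ y)))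
                               (λ _ → subst (_< s) (sym (∑-zero (allFin n))) s>0)

  -- `χ` assigns the vertices of T to two disjoint hosts, and the root w is pinned to u. By `room`,
  -- the image of a parent has as many neighbours in the host of its child as that host has to
  -- receive vertices; for the parent w this concerns u alone.
  module _ {N : ℕ} (G : Graph (Fin N)) (χ : Fin n → Bool) (host : Bool → Fin N → Bool) (u : Fin N) (w : Fin n)
           (disjoint : ∀ {x} → host true ∋ x → host false ∋ x → ⊥)
           (u∈ : host (χ w) ∋ u)
           (room : ∀ {p v} → Edge T p v → v ≢ w → ∀ {x} → host (χ p) ∋ x → (p ≡ w → x ≡ u) →
                   ∣ (λ t → does (χ t Bool.≟ χ v)) ∣ ≤ ∣ adj G x ∩ host (χ v) ∣) where

    -- A partial embedding as a total function, arbitrary outside l apart from its value at the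
    -- root.
    record Embedding (l : List (Fin n)) : Set where
      field
        f         : Fin n → Fin N
        root-at   : f w ≡ u
        hosted    : ∀ {t} → t ∈ l → host (χ t) ∋ f t
        injective : ∀ {s t} → s ∈ l → t ∈ l → f s ≡ f t → s ≡ t
        edges     : ∀ {s t} → s ∈ l → t ∈ l → Edge T s t → Edge G (f s) (f t)

    host-unique : ∀ {x} b c → host b ∋ x → host c ∋ x → b ≡ c
    host-unique true  true  _ _ = refl
    host-unique false false _ _ = refl
    host-unique true  false h k = ⊥-elim (disjoint h k)
    host-unique false true  h k = ⊥-elim (disjoint k h)

    greedy : ∀ {l} → Grown w l → Embedding l
    greedy root = record
      { f         = λ _ → u
      ; root-at   = refl
      ; hosted    = λ { (here refl) → u∈ }
      ; injective = λ { (here refl) (here refl) _ → refl }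
      ; edges     = λ { (here refl) (here refl) e → ⊥-elim (true≢false e (adj-irrefl T w)) }
      }
    greedy {v ∷ l} (grow p g v∉ p∈ e parent) = extend (avoid candidates used enough)
      where
      open Embedding (greedy g)
      open ≤-Reasoning
      candidates : Fin N → Bool
      candidates = adj G (f p) ∩ host (χ v)
      same : ∀ t → Dec (χ t ≡ χ v)
      same t = χ t Bool.≟ χ v
      used : List (Fin N)
      used = map f (filter same l)
      -- Strict because v belongs to its own colour class without being placed yet. Images of the
      -- other colour lie in the other host and need no avoiding.
      enough : length used < ∣ candidates ∣
      enough = begin-strict
        length used                   ≡⟨ length-map f (filter same l) ⟩
        length (filter same l)        <⟨ unique-length (λ t → does (same t)) {v ∷ filter same l}
                                           (all-∉ (λ v∈ → v∉ (proj₁ (∈-filter⁻ same v∈))) ∷ Unique.filter⁺ same (Grown-unique g))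
                                           (dec-true (same v) refl ∷ All.map (λ {t} eq → dec-true (same t) eq) (All.all-filter same l)) ⟩
        ∣ (λ t → does (same t)) ∣     ≤⟨ room e (λ v≡w → v∉ (subst (_∈ l) (sym v≡w) (root∈ g))) (hosted p∈)
                                              (λ p≡w → trans (cong f p≡w) root-at) ⟩
        ∣ candidates ∣                ∎
      extend : ∃[ h ] candidates ∋ h × h ∉ used → Embedding (v ∷ l)
      extend (h , h∈ , h∉) = record
        { f         = f′
        ; root-at   = trans (f′-old (root∈ g)) root-at
        ; hosted    = λ { (here refl) → subst (host (χ v) ∋_) (sym f′-v) (proj₂ (∧-true {adj G (f p) h} h∈))
                        ; (there t∈)  → subst (host _ ∋_) (sym (f′-old t∈)) (hosted t∈) }
        ; injective = injective′
        ; edges     = edges′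
        }
        where
        f′ : Fin n → Fin N
        f′ t = if does (t Fin.≟ v) then h else f t
        f′-v : f′ v ≡ h
        f′-v rewrite dec-true (v Fin.≟ v) refl = refl
        f′-old : ∀ {t} → t ∈ l → f′ t ≡ f t
        f′-old {t} t∈ rewrite dec-false (t Fin.≟ v) (λ t≡v → v∉ (subst (_∈ l) t≡v t∈)) = refl
        fresh : ∀ {t} → t ∈ l → h ≢ f t
        fresh {t} t∈ h≡ = h∉ (subst (_∈ used) (sym h≡) (∈-map⁺ f (∈-filter⁺ same t∈
          (host-unique (χ t) (χ v) (hosted t∈) (subst (host (χ v) ∋_) h≡ (proj₂ (∧-true {adj G (f p) h} h∈)))))))
        injective′ : ∀ {s t} → s ∈ v ∷ l → t ∈ v ∷ l → f′ s ≡ f′ t → s ≡ t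
        injective′ (here refl) (here refl) eq = refl
        injective′ (here refl) (there t∈)  eq = ⊥-elim (fresh t∈ (trans (sym f′-v) (trans eq (f′-old t∈))))
        injective′ (there s∈)  (here refl) eq = ⊥-elim (fresh s∈ (trans (sym f′-v) (trans (sym eq) (f′-old s∈))))
        injective′ (there s∈)  (there t∈)  eq = injective s∈ t∈ (trans (sym (f′-old s∈)) (trans eq (f′-old t∈)))
        -- Adjacency of h to f p suffices, p being the only earlier neighbour of v.
        new-edge : ∀ {t} → t ∈ l → Edge T t v → Edge G (f′ t) (f′ v)
        new-edge t∈ tv rewrite parent t∈ tv = subst₂ (Edge G) (sym (f′-old p∈)) (sym f′-v) (proj₁ (∧-true h∈))
        edges′ : ∀ {s t} → s ∈ v ∷ l → t ∈ v ∷ l → Edge T s t → Edge G (f′ s) (f′ t)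
        edges′ (here refl) (here refl) st = ⊥-elim (true≢false st (adj-irrefl T v))
        edges′ (here refl) (there t∈)  st = trans (adj-sym G _ _) (new-edge t∈ (Edge-sym st))
        edges′ (there s∈)  (here refl) st = new-edge s∈ st
        edges′ (there s∈)  (there t∈)  st = subst₂ (Edge G) (sym (f′-old s∈)) (sym (f′-old t∈)) (edges s∈ t∈ st)

    embed : IsTree T → Contains G T
    embed ((_ , conn) , acyclic) with spanning acyclic conn w
    ... | l , g , all∈ = f , injective (all∈ _) (all∈ _) , edges (all∈ _) (all∈ _)
      where open Embedding (greedy g)

-- Stability

-- One step of the induction in `stability` turns an allowance c into loss q * c:
-- a near-clique of slack x = (q + 2) * c has fewer than 4 (q + 1) x edges leaving
-- any of its vertices.
loss : ℕ → ℕ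
loss q = q + 2 + 2 * (2 * (q + 2)) * suc q + 1

-- With E = `total-loss q` and B = `loss q`, E (k + 1) * c = E k * (B * c) + B * c: one step raises
-- the allowance from c to B * c and may cost B * c vertices of D.
total-loss : ℕ → ℕ → ℕ
total-loss q zero    = 1
total-loss q (suc k) = loss q * total-loss q k + loss q

module _ {N : ℕ} (G : Graph (Fin N)) where

  deg : (Fin N → Bool) → Fin N → ℕ
  deg S v = ∣ adj G v ∩ S ∣

  far : (Fin N → Bool) → Fin N → Fin N → Bool
  far S v = S ∩ adj (complement G) v

  -- The additional 1 is v itself, which is neither its own neighbour nor far from itself.
  ∣∣≤deg+far : ∀ S v → ∣ S ∣ ≤ deg S v + suc ∣ far S v ∣
  ∣∣≤deg+far S v = begin
    ∣ S ∣                                        ≤⟨ ∑-mono (allFin N) pointwise ⟩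
    ∑ (allFin N) (λ y → 𝟙 ((adj G v ∩ S) y) + (𝟙 (singleton v y) + 𝟙 (far S v y)))
      ≡⟨ trans (∑-+ (allFin N) _ _) (cong (deg S v +_) (∑-+ (allFin N) _ _)) ⟩
    deg S v + (∣ singleton v ∣ + ∣ far S v ∣)    ≡⟨ cong (λ k → deg S v + (k + ∣ far S v ∣)) (∣singleton∣ v) ⟩
    deg S v + suc ∣ far S v ∣                    ∎
    where
    open ≤-Reasoning
    pointwise : ∀ y → 𝟙 (S y) ≤ 𝟙 (adj G v y ∧ S y) + (𝟙 (singleton v y) + 𝟙 (S y ∧ (not (adj G v y) ∧ not (does (v Fin.≟ y)))))
    pointwise y with S y | adj G v y | y Fin.≟ v
    ... | false | _     | _       = z≤n
    ... | true  | true  | _       = s≤s z≤n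
    ... | true  | false | yes _   = s≤s z≤n
    ... | true  | false | no y≢v rewrite dec-false (v Fin.≟ y) (y≢v ∘ sym) = ≤-refl

  -- Such a Z exists exactly when the d-core of the graph induced on Y is nonempty.
  Core : ℕ → (Fin N → Bool) → Set
  Core d Y = ∃[ Z ] (∃[ v ] Z ∋ v) × Z ⊆ Y × (∀ {v} → Z ∋ v → d ≤ deg Z v)

  Core-mono : ∀ {d Y Y′} → Y ⊆ Y′ → Core d Y → Core d Y′
  Core-mono sub (Z , ne , Z⊆Y , mindeg) = Z , ne , (λ v Zv → sub v (Z⊆Y v Zv)) , mindeg

  deg-∖ : ∀ S L v → deg S v ≤ ∣ L ∣ + deg (S ∖ L) v
  deg-∖ S L v = ≤-trans (∣∖∣-≤ (adj G v ∩ S) L)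
    (+-monoʳ-≤ ∣ L ∣ (∣∣-mono {N} {(adj G v ∩ S) ∖ L} {adj G v ∩ (S ∖ L)} reassoc))
    where
    reassoc : (adj G v ∩ S) ∖ L ⊆ adj G v ∩ (S ∖ L)
    reassoc y h with ∧-true {adj G v y ∧ S y} h
    ... | vS , ¬L with ∧-true {adj G v y} vS
    ... | vy , Sy = true-∧ vy (true-∧ Sy ¬L)

  deg≤∣∣ : ∀ S v → deg S v ≤ ∣ S ∣
  deg≤∣∣ S v = ∣∣-mono {N} {adj G v ∩ S} {S} (λ y h → proj₂ (∧-true {adj G v y} h))

  sparse : (Fin N → Bool) → ℕ → Fin N → Bool
  sparse Y d v = Y v ∧ does (deg Y v <? d)

  -- If fewer than c vertices had degree below d + c, deleting them would cost the others less than
  -- c neighbours each and leave a core of minimum degree d.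
  peel : ∀ d c Y → c ≤ ∣ Y ∣ → ¬ Core d Y → c ≤ ∣ sparse Y (d + c) ∣
  peel d c Y c≤Y ¬core = ≮⇒≥ λ small → ¬core (core small)
    where
    L = sparse Y (d + c)
    core : ∣ L ∣ < c → Core d Y
    core small = Y ∖ L , nonempty , (λ v h → proj₁ (∧-true {Y v} h)) , mindeg
      where
      nonempty : ∃[ v ] Y ∖ L ∋ v
      nonempty with ∣∣-pick L Y (<-≤-trans small c≤Y)
      ... | v , Yv , ¬Lv = v , true-∧ Yv (cong not ¬Lv)
      mindeg : ∀ {v} → Y ∖ L ∋ v → d ≤ deg (Y ∖ L) v
      mindeg {v} h with ∧-true {Y v} h
      ... | Yv , ¬Lv = +-cancelʳ-≤ c d _ (begin
        d + c                       ≤⟨ ≮⇒≥ (λ lt → true≢false (true-∧ Yv (dec-true (deg Y v <? d + c) lt)) (not-true ¬Lv)) ⟩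
        deg Y v                     ≤⟨ deg-∖ Y L v ⟩
        ∣ L ∣ + deg (Y ∖ L) v       ≤⟨ +-monoˡ-≤ _ (<⇒≤ small) ⟩
        c + deg (Y ∖ L) v           ≡⟨ +-comm c _ ⟩
        deg (Y ∖ L) v + c           ∎)
        where open ≤-Reasoning

  sparse⇒far : ∀ {S d v} → sparse S d ∋ v → S ∋ v × ∣ S ∣ ≤ d + ∣ far S v ∣
  sparse⇒far {S} {d} {v} h with ∧-true {S v} h
  ... | Sv , lt = Sv , (begin
    ∣ S ∣                       ≤⟨ ∣∣≤deg+far S v ⟩
    deg S v + suc ∣ far S v ∣   ≡⟨ +-suc (deg S v) _ ⟩
    suc (deg S v) + ∣ far S v ∣ ≤⟨ +-monoˡ-≤ _ (does-true (deg S v <? d) lt) ⟩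
    d + ∣ far S v ∣             ∎)
    where open ≤-Reasoning

  -- Peeling with c = d gives d first vertices of degree below 2 * d. Passing to the far set of one
  -- of them costs at most 2 * d vertices, and this happens k times.
  coreless⇒cliques : ∀ d k Y → 2 * d * k ≤ ∣ Y ∣ → ¬ Core d Y → d ^ k ≤ cliques (complement G) k Y
  coreless⇒cliques d zero    Y large ¬core = ≤-refl
  coreless⇒cliques d (suc k) Y large ¬core = begin
    d * d ^ k                          ≤⟨ *-monoˡ-≤ (d ^ k) (peel d d Y d≤Y ¬core) ⟩
    ∣ sparse Y (d + d) ∣ * d ^ k       ≤⟨ cliques-suc (complement G) k Y (sparse Y (d + d)) (d ^ k)
                                            (λ v h → proj₁ (∧-true {Y v} h)) many ⟩
    cliques (complement G) (suc k) Y   ∎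
    where
    open ≤-Reasoning
    split-large : ∀ d k → d + (d + 2 * d * k) ≡ 2 * d * suc k
    split-large = solve-∀
    d≤Y : d ≤ ∣ Y ∣
    d≤Y = ≤-trans (≤-trans (m≤m+n d _) (≤-reflexive (split-large d k))) large
    many : ∀ v → sparse Y (d + d) ∋ v → d ^ k ≤ cliques (complement G) k (far Y v)
    many v h = coreless⇒cliques d k (far Y v)
      (+-cancelˡ-≤ (d + d) _ _ (begin
        d + d + 2 * d * k     ≡⟨ trans (+-assoc d d _) (split-large d k) ⟩
        2 * d * suc k         ≤⟨ large ⟩
        ∣ Y ∣                 ≤⟨ proj₂ (sparse⇒far {Y} h) ⟩
        d + d + ∣ far Y v ∣   ∎))
      (λ core → ¬core (Core-mono (λ y h → proj₁ (∧-true {Y y} h)) core))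

  module _ {n : ℕ} (T : Graph (Fin n)) (tree : IsTree T) where

    -- Greedy embedding with a single host, the other one being empty.
    core⇒Contains : ∀ {Y d} → n ≤ d → Core d Y → Contains G T
    core⇒Contains n≤d (Z , (u , u∈) , _ , mindeg) =
      embed T G (λ _ → true) host u (proj₁ (proj₁ tree)) (λ _ ()) u∈
        (λ _ _ x∈ _ → ≤-trans (∣∣≤n _) (≤-trans n≤d (mindeg x∈))) tree
      where
      host : Bool → Fin N → Bool
      host true  = Z
      host false = λ _ → false

    -- The vertex w goes to u, a union X of branches at w with between x and 2 * x vertices goes
    -- into Z, and the at most n - x other vertices stay in A.
    escape : ∀ {A Z u x} → A ∋ u → (∀ {v} → A ∋ v → n ≤ deg A v + x) →
             Z ⊆ adj G u ∖ A → (∃[ v ] Z ∋ v) → (∀ {v} → Z ∋ v → 2 * x ≤ deg Z v) →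
             1 ≤ x → x < n → Contains G T
    escape {A} {Z} {u} {x} u∈ degA Z⊆ (c , c∈) degZ x>0 x<n with split T x x<n tree x>0
    ... | X , w , (w∉X , closed) , x≤X , X≤2x =
      embed T G (λ t → not (X t)) host u w disjoint (subst (λ b → host (not b) ∋ u) (sym w∉X) u∈) room tree
      where
      open ≤-Reasoning
      host : Bool → Fin N → Bool
      host true  = A
      host false = Z
      disjoint : ∀ {y} → A ∋ y → Z ∋ y → ⊥
      disjoint {y} Ay Zy = true≢false Ay (not-true (proj₂ (∧-true {adj G u y} (Z⊆ y Zy))))
      outside : ∣ (λ t → does (not (X t) Bool.≟ true)) ∣ + x ≤ n
      outside = begin
        ∣ (λ t → does (not (X t) Bool.≟ true)) ∣ + x   ≤⟨ +-mono-≤ (∣∣-mono {n} {λ t → does (not (X t) Bool.≟ true)} {full ∖ X} (λ t h → does-true (not (X t) Bool.≟ true) h)) x≤X ⟩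
        ∣ full ∖ X ∣ + ∣ X ∣                           ≡⟨ +-comm ∣ full ∖ X ∣ _ ⟩
        ∣ full ∩ X ∣ + ∣ full ∖ X ∣                    ≡⟨ ∣∣-split full X ⟨
        ∣ full {Fin n} ∣                               ≡⟨ ∣full∣ ⟩
        n                                              ∎
      inside : ∣ (λ t → does (not (X t) Bool.≟ false)) ∣ ≤ 2 * x
      inside = ≤-trans (∣∣-mono {n} {λ t → does (not (X t) Bool.≟ false)} {X} in-X) X≤2x
        where
        in-X : ∀ t → does (not (X t) Bool.≟ false) ≡ true → X t ≡ true
        in-X t h with X t
        ... | true = refl
      -- All of Z is adjacent to u, and Z has at least 2 * x vertices since one of them has that
      -- many neighbours in Z.
      Z-sees : ∀ {y} → y ≡ u → 2 * x ≤ deg Z y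
      Z-sees refl = ≤-trans (≤-trans (degZ c∈) (deg≤∣∣ Z c))
        (∣∣-mono {N} {Z} {adj G u ∩ Z} (λ y Zy → true-∧ (proj₁ (∧-true {adj G u y} (Z⊆ y Zy))) Zy))
      room : ∀ {p v} → Edge T p v → v ≢ w → ∀ {y} → host (not (X p)) ∋ y → (p ≡ w → y ≡ u) →
             ∣ (λ t → does (not (X t) Bool.≟ not (X v))) ∣ ≤ ∣ adj G y ∩ host (not (X v)) ∣
      room {p} {v} pv v≢w y∈ at-w with X p in Xp | X v in Xv
      ... | false | false = +-cancelʳ-≤ x _ _ (≤-trans outside (degA y∈))
      ... | true  | true  = ≤-trans inside (degZ y∈)
      -- An edge between X and the rest ends in w outside X. As w is the root, it occurs only with w
      -- as the parent.
      ... | false | true  with closed Xv (Edge-sym T pv)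
      ...   | inj₁ p∈X = ⊥-elim (true≢false p∈X Xp)
      ...   | inj₂ p≡w = ≤-trans inside (Z-sees (at-w p≡w))
      room {p} {v} pv v≢w y∈ at-w | true | false with closed Xp pv
      ...   | inj₁ v∈X = ⊥-elim (true≢false v∈X Xv)
      ...   | inj₂ v≡w = ⊥-elim (v≢w v≡w)

    record NearClique (x : ℕ) (S : Fin N → Bool) : Set where
      field
        A        : Fin N → Bool
        nonempty : ∃[ v ] A ∋ v
        inside   : A ⊆ S
        mindeg   : ∀ {v} → A ∋ v → n ≤ deg A v + x
        small    : ∣ A ∣ ≤ n + x

    NearClique-mono : ∀ {x S S′} → S ⊆ S′ → NearClique x S → NearClique x S′
    NearClique-mono sub nc = record
      { A = A ; nonempty = nonempty ; inside = λ v Av → sub v (inside v Av) ; mindeg = mindeg ; small = small }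
      where open NearClique nc

    module _ (T⊈G : ¬ Contains G T) where

      no-core : ∀ {d Y} → n ≤ d → ¬ Core d Y
      no-core n≤d core = T⊈G (core⇒Contains n≤d core)

      -- c is the shortfall of S against n * (k + 1). Each peeling step takes at most n + s vertices
      -- and so adds s to the shortfall; x leaves room for all of these and for the 2 * s lost in
      -- the last step, where pairs are counted.
      no-near-clique⇒cliques : ∀ k s c x S → 1 ≤ s → c + s * (2 + k) ≤ x → x ≤ n →
        n * suc k ≤ ∣ S ∣ + c → ¬ NearClique x S →
        s ^ (2 + k) ≤ cliques (complement G) (2 + k) S
      no-near-clique⇒cliques zero s c x S s>0 cs≤x x≤n large ¬nc = begin
        s ^ 2                            ≡⟨ cong (s *_) (*-identityʳ s) ⟩
        s * s                            ≤⟨ *-monoˡ-≤ s (≮⇒≥ (λ few → impossible few)) ⟩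
        ∣ L ∣ * s                        ≤⟨ cliques-suc (complement G) 1 S L s (λ v h → proj₁ (∧-true {S v} h)) many ⟩
        cliques (complement G) 2 S       ∎
        where
        open ≤-Reasoning
        L : Fin N → Bool
        L v = S v ∧ does (s ≤? ∣ far S v ∣)
        many : ∀ v → L ∋ v → s ≤ cliques (complement G) 1 (far S v)
        many v h = ≤-trans (does-true (s ≤? ∣ far S v ∣) (proj₂ (∧-true {S v} h)))
                           (cliques-1 (complement G) (far S v))
        n≤ : n ≤ ∣ S ∣ + c
        n≤ = ≤-trans (≤-reflexive (sym (*-identityʳ n))) large
        s≤S : s ≤ ∣ S ∣
        s≤S = linear s (cs≤x ⊕ x≤n ⊕ n≤) (ident s c x n (∣ S ∣))
          where
          ident : ∀ s c x n S → s + (x + (n + (S + c))) + s ≡ S + (c + s * 2 + (x + n))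
          ident = solve-∀
        A : Fin N → Bool
        A = S ∖ L
        A⊆S : A ⊆ S
        A⊆S v h = proj₁ (∧-true {S v} h)
        module _ (few : ∣ L ∣ < s) where
          degA : ∀ {v} → A ∋ v → ∣ S ∣ ≤ deg A v + (s + s)
          degA {v} h with ∧-true {S v} h
          ... | Sv , ¬Lv = begin
            ∣ S ∣                                ≤⟨ ∣∣≤deg+far S v ⟩
            deg S v + suc ∣ far S v ∣            ≤⟨ +-mono-≤ (deg-∖ S L v) (≰⇒> (λ le → true≢false (true-∧ Sv (dec-true (s ≤? ∣ far S v ∣) le)) (not-true ¬Lv))) ⟩
            ∣ L ∣ + deg A v + s                  ≤⟨ +-monoˡ-≤ s (+-monoˡ-≤ _ (<⇒≤ few)) ⟩
            s + deg A v + s                      ≡⟨ ident s (deg A v) ⟩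
            deg A v + (s + s)                    ∎
            where
            ident : ∀ s d → s + d + s ≡ d + (s + s)
            ident = solve-∀
          A-nonempty : ∃[ v ] A ∋ v
          A-nonempty with ∣∣-pick L S (<-≤-trans few s≤S)
          ... | v , Sv , ¬Lv = v , true-∧ Sv (cong not ¬Lv)
          -- Every vertex of A has at least ∣ S ∣ - 2 * s neighbours in A. For ∣ S ∣ ≤ n + x this
          -- makes A a near-clique, for larger S a core of minimum degree n.
          impossible : ⊥
          impossible with ∣ S ∣ ≤? n + x
          ... | yes S≤ = ¬nc (record
            { A = A ; nonempty = A-nonempty ; inside = A⊆S
            ; mindeg = λ {v} h → linear 0 (n≤ ⊕ degA h ⊕ cs≤x) (ident n (∣ S ∣) c (deg A v) s x)
            ; small = ≤-trans (∣∣-mono {N} {A} {S} A⊆S) S≤ })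
            where
            ident : ∀ n S c d s x → n + (S + c + (d + (s + s) + x)) + 0 ≡ d + x + (n + (S + (c + s * 2)))
            ident = solve-∀
          ... | no S≰ = no-core ≤-refl (A , A-nonempty , A⊆S ,
            λ {v} h → linear c (<⇒≤ (≰⇒> S≰) ⊕ degA h ⊕ cs≤x) (ident n (∣ S ∣) c (deg A v) s x))
            where
            ident : ∀ n S c d s x → n + (S + (d + (s + s) + x)) + c ≡ d + (n + x + (S + (c + s * 2)))
            ident = solve-∀
      no-near-clique⇒cliques (suc k) s c x S s>0 cs≤x x≤n large ¬nc = begin
        s * s ^ (2 + k)                        ≤⟨ *-monoˡ-≤ (s ^ (2 + k)) (peel n s S s≤S (no-core ≤-refl)) ⟩
        ∣ sparse S (n + s) ∣ * s ^ (2 + k)     ≤⟨ cliques-suc (complement G) (2 + k) S (sparse S (n + s)) (s ^ (2 + k))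
                                                    (λ v h → proj₁ (∧-true {S v} h)) many ⟩
        cliques (complement G) (3 + k) S       ∎
        where
        open ≤-Reasoning
        s≤S : s ≤ ∣ S ∣
        s≤S = linear (n * suc k + s * (2 + k)) (cs≤x ⊕ x≤n ⊕ large) (ident s c x n (∣ S ∣) k)
          where
          ident : ∀ s c x n S k → s + (x + (n + (S + c))) + (n * suc k + s * (2 + k)) ≡ S + (c + s * (3 + k) + (x + n * (2 + k)))
          ident = solve-∀
        many : ∀ v → sparse S (n + s) ∋ v → s ^ (2 + k) ≤ cliques (complement G) (2 + k) (far S v)
        many v h = no-near-clique⇒cliques k s (c + s) x (far S v) s>0
          (≤-trans (≤-reflexive (ident₁ c s k)) cs≤x) x≤n
          (linear 0 (large ⊕ proj₂ (sparse⇒far {S} h)) (ident₂ n k (∣ S ∣) c s (∣ far S v ∣)))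
          (λ nc → ¬nc (NearClique-mono (λ y h → proj₁ (∧-true {S y} h)) nc))
          where
          ident₁ : ∀ c s k → c + s + s * (2 + k) ≡ c + s * (3 + k)
          ident₁ = solve-∀
          ident₂ : ∀ n k S c s f → n * suc k + (S + c + (n + s + f)) + 0 ≡ f + (c + s) + (n * (2 + k) + S)
          ident₂ = solve-∀

      module _ (q s : ℕ) (s>0 : 1 ≤ s) (few : ∀ S → cliques (complement G) (suc q) S < s ^ suc q) where

        -- A large neighbourhood outside A either has a core of minimum degree 2 * x, into which
        -- branches of T escape, or has none and then spans too many cliques of the complement.
        near-clique⇒few-out : ∀ {x S} (nc : NearClique x S) → s ≤ x → x < n →
          ∀ {u} → NearClique.A nc ∋ u → ∣ adj G u ∖ NearClique.A nc ∣ < 2 * (2 * x) * suc q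
        near-clique⇒few-out {x} nc s≤x x<n {u} u∈ = ≰⇒> λ large →
          <⇒≱ (few (adj G u ∖ A)) (≤-trans (^-monoˡ-≤ (suc q) (≤-trans s≤x (m≤m+n x _)))
            (coreless⇒cliques (2 * x) (suc q) (adj G u ∖ A) large
              (λ (Z , ne , Z⊆ , degZ) → T⊈G (escape u∈ mindeg Z⊆ ne degZ (≤-trans s>0 s≤x) x<n))))
          where open NearClique nc

        private
          B : ℕ
          B = loss q
          E : ℕ → ℕ
          E = total-loss q

        module _ (Δ : ℕ) (Δ≤n : Δ ≤ n) (D : Fin N → Bool)
                 (D-deg : ∀ {v} → D ∋ v → n + Δ ≤ ∣ adj G v ∣) where

          -- The invariant: S falls short of n * k by at most c, and D keeps E k * c vertices in S,
          -- enough for k steps that each multiply c by `loss q` and cost D at most the new c. At k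
          -- = 0 the survivors of D are the cliques of order 1.
          stability : ∀ k c S → k ≤ q → s ≤ c → E k * c ≤ Δ → E k * c ≤ ∣ D ∩ S ∣ →
                      n * k ≤ ∣ S ∣ + c → s ^ suc k ≤ cliques (complement G) (suc k) S
          stability zero c S k≤q s≤c Ec≤Δ Ec≤D large = begin
            s * 1                             ≡⟨ *-identityʳ s ⟩
            s                                 ≤⟨ s≤c ⟩
            c                                 ≡⟨ *-identityˡ c ⟨
            1 * c                             ≤⟨ Ec≤D ⟩
            ∣ D ∩ S ∣                         ≤⟨ ∣∣-mono {N} {D ∩ S} {S} (λ y h → proj₂ (∧-true {D y} h)) ⟩
            ∣ S ∣                             ≤⟨ cliques-1 (complement G) S ⟩
            cliques (complement G) 1 S        ∎
            where open ≤-Reasoning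
          -- Whether S contains a near-clique is not decided. The goal is a decidable inequality, so
          -- both cases may be used to refute its negation.
          stability (suc k) c S k<q s≤c Ec≤Δ Ec≤D large = decidable-stable (_ ≤? _) λ ¬goal →
            ¬goal (no-near-clique⇒cliques k s c x S s>0 slack x≤n
              large (λ nc → ¬goal (step-from nc)))
            where
            open ≤-Reasoning
            x : ℕ
            -- Chosen as c + (q + 1) * c: since s ≤ c and k < q, this is at least c + s * (2 + k).
            x = (q + 2) * c
            o : ℕ
            o = 2 * (2 * x) * suc q
            Bc≡ : B * c ≡ x + o + c
            Bc≡ = ident q c
              where
              ident : ∀ q c → (q + 2 + 2 * (2 * (q + 2)) * suc q + 1) * c ≡ (q + 2) * c + 2 * (2 * ((q + 2) * c)) * suc q + c
              ident = solve-∀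
            Bc≤Δ : B * c ≤ Δ
            Bc≤Δ = ≤-trans (*-monoˡ-≤ c (m≤n+m B (B * E k))) Ec≤Δ
            x+s≤n : x + s ≤ n
            x+s≤n = begin
              x + s          ≤⟨ +-monoʳ-≤ x s≤c ⟩
              x + c          ≤⟨ +-monoˡ-≤ c (m≤m+n x o) ⟩
              x + o + c      ≡⟨ Bc≡ ⟨
              B * c          ≤⟨ Bc≤Δ ⟩
              Δ              ≤⟨ Δ≤n ⟩
              n              ∎
            x≤n : x ≤ n
            x≤n = ≤-trans (m≤m+n x s) x+s≤n
            x<n : x < n
            x<n = <-≤-trans (m<m+n x s>0) x+s≤n
            slack : c + s * (2 + k) ≤ x
            slack = begin
              c + s * (2 + k)      ≤⟨ +-monoʳ-≤ c (*-mono-≤ s≤c (s≤s k<q)) ⟩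
              c + c * suc q        ≡⟨ ident c q ⟩
              x                    ∎
              where
              ident : ∀ c q → c + c * suc q ≡ (q + 2) * c
              ident = solve-∀
            s≤x : s ≤ x
            s≤x = ≤-trans s≤c (m≤m*n′ c)
              where
              m≤m*n′ : ∀ c → c ≤ (q + 2) * c
              m≤m*n′ c = ≤-trans (≤-reflexive (sym (*-identityˡ c))) (*-monoˡ-≤ c (≤-trans (s≤s z≤n) (m≤n+m 2 q)))
            step-from : NearClique x S → s ^ (2 + k) ≤ cliques (complement G) (2 + k) S
            step-from nc = begin
              s * s ^ suc k                        ≤⟨ *-monoˡ-≤ (s ^ suc k) s≤A ⟩
              ∣ A ∣ * s ^ suc k                    ≤⟨ cliques-suc (complement G) (suc k) S A (s ^ suc k) inside recurse ⟩
              cliques (complement G) (2 + k) S     ∎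
              where
              open NearClique nc
              out : Fin N → ℕ
              out v = ∣ adj G v ∖ A ∣
              out< : ∀ {v} → A ∋ v → out v < o
              out< = near-clique⇒few-out nc s≤x x<n
              s≤A : s ≤ ∣ A ∣
              s≤A with nonempty
              ... | v , Av = linear 0 (x+s≤n ⊕ mindeg Av ⊕ deg≤∣∣ A v) (ident s n (deg A v) x (∣ A ∣))
                where
                ident : ∀ s n d x A → s + (n + (d + x + A)) + 0 ≡ A + (x + s + (n + d))
                ident = solve-∀
              -- Vertices of A have degree below n + x + o, and x + o ≤ B * c ≤ Δ.
              A∩D=∅ : ∀ {v} → A ∋ v → D ∋ v → ⊥
              A∩D=∅ {v} Av Dv = n≮n Δ (begin-strict
                Δ                          ≤⟨ linear 0 (D-deg Dv ⊕ ∣∖∣-≤ (adj G v) A ⊕ small) (ident Δ (∣ adj G v ∣) (∣ A ∣) (out v) n x) ⟩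
                x + out v                  <⟨ +-monoʳ-< x (out< Av) ⟩
                x + o                      ≤⟨ m≤m+n (x + o) c ⟩
                x + o + c                  ≡⟨ Bc≡ ⟨
                B * c                      ≤⟨ Bc≤Δ ⟩
                Δ                          ∎)
                where
                ident : ∀ Δ d A o n x → Δ + (d + (A + o + (n + x))) + 0 ≡ x + o + (n + Δ + (d + A))
                ident = solve-∀
              recurse : ∀ v → A ∋ v → s ^ suc k ≤ cliques (complement G) (suc k) (far S v)
              recurse v Av = stability k (B * c) (far S v) (≤-trans (n≤1+n k) k<q)
                (≤-trans s≤c c≤Bc) (≤-trans EBc≤ Ec≤Δ) D-far far-large
                where
                c≤Bc : c ≤ B * c
                c≤Bc = ≤-trans (m≤n+m c (x + o)) (≤-reflexive (sym Bc≡))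
                swap : ∀ E B c → E * (B * c) + B * c ≡ (B * E + B) * c
                swap = solve-∀
                EBc≤ : E k * (B * c) ≤ E (suc k) * c
                EBc≤ = ≤-trans (m≤m+n _ (B * c)) (≤-reflexive (swap (E k) B c))
                -- D loses only neighbours of v, and these lie outside A because A and D are
                -- disjoint: there are fewer than o of them.
                near-far : (D ∩ S) ∖ (adj G v ∖ A) ⊆ D ∩ far S v
                near-far y h with ∧-true {D y ∧ S y} h
                ... | DS , ¬out with ∧-true {D y} DS
                ... | Dy , Sy = true-∧ Dy (true-∧ Sy (true-∧ (non-adjacent (dichotomy (adj G v y)))
                                  (cong not (dec-false (v Fin.≟ y) (λ { refl → A∩D=∅ Av Dy })))))
                  where
                  non-adjacent : adj G v y ≡ true ⊎ adj G v y ≡ false → not (adj G v y) ≡ true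
                  non-adjacent (inj₂ no-edge) = cong not no-edge
                  non-adjacent (inj₁ edge) with dichotomy (A y)
                  ... | inj₁ Ay = ⊥-elim (A∩D=∅ Ay Dy)
                  ... | inj₂ ¬Ay = ⊥-elim (true≢false (true-∧ edge (cong not ¬Ay)) (not-true ¬out))
                D-far : E k * (B * c) ≤ ∣ D ∩ far S v ∣
                D-far = +-cancelʳ-≤ (B * c) _ _ (begin
                  E k * (B * c) + B * c                            ≡⟨ swap (E k) B c ⟩
                  E (suc k) * c                                    ≤⟨ Ec≤D ⟩
                  ∣ D ∩ S ∣                                        ≤⟨ ∣∖∣-≤ (D ∩ S) (adj G v ∖ A) ⟩
                  out v + ∣ (D ∩ S) ∖ (adj G v ∖ A) ∣              ≤⟨ +-mono-≤ out≤Bc (∣∣-mono {N} {(D ∩ S) ∖ (adj G v ∖ A)} near-far) ⟩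
                  B * c + ∣ D ∩ far S v ∣                          ≡⟨ +-comm (B * c) _ ⟩
                  ∣ D ∩ far S v ∣ + B * c                          ∎)
                  where
                  out≤Bc : out v ≤ B * c
                  out≤Bc = ≤-trans (<⇒≤ (out< Av)) (≤-trans (m≤n+m o x) (≤-trans (m≤m+n (x + o) c) (≤-reflexive (sym Bc≡))))
                -- The degree of v in S is below n + x + o, so the shortfall grows from c to at most
                -- x + o + c; the strict bound pays for v itself.
                far-large : n * k ≤ ∣ far S v ∣ + B * c
                far-large = subst (λ z → n * k ≤ ∣ far S v ∣ + z) (sym Bc≡)
                  (linear 0 (large ⊕ ∣∣≤deg+far S v ⊕ degS ⊕ out< Av ⊕ small) (ident n k (∣ S ∣) c (deg S v) (∣ far S v ∣) (∣ A ∣) (out v) o x))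
                  where
                  degS : deg S v ≤ ∣ A ∣ + out v
                  degS = ≤-trans (∣∣-mono {N} {adj G v ∩ S} {adj G v} (λ y h → proj₁ (∧-true {adj G v y} h))) (∣∖∣-≤ (adj G v) A)
                  ident : ∀ n k S c d f A out o x →
                    n * k + (S + c + (d + suc f + (A + out + (o + (n + x))))) + 0 ≡
                    f + (x + o + c) + (n * suc k + (S + (d + (suc out + A))))
                  ident = solve-∀

-- Edges and degrees

-- The search rebuilds f from its first value and its tail, which agrees with f only pointwise;
-- hence the requirement that P respect pointwise equality.
any-function? : ∀ n {N} {P : (Fin n → Fin N) → Set} → (∀ {f g} → f ≗ g → P f → P g) →
                (∀ f → Dec (P f)) → Dec (∃ P)
any-function? zero {N} resp P? = map′ (none ,_) (λ (f , p) → resp (λ ()) p) (P? none)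
  where
  none : Fin 0 → Fin N
  none ()
any-function? (suc n) {P = P} resp P? =
  map′ (λ (x , f , p) → x Func.∷ f , p)
       (λ (f , p) → f zero , f ∘ suc , resp (λ { zero → refl ; (suc i) → refl }) p)
       (Fin.any? λ x → any-function? n {P = λ f → P (x Func.∷ f)}
         (λ f≗g → resp (λ { zero → refl ; (suc i) → f≗g i }))
         (λ f → P? (x Func.∷ f)))

-- Makes it legitimate to prove the theorem by refuting T ⊈ G.
Contains? : ∀ {n N} (G : Graph (Fin N)) (T : Graph (Fin n)) → Dec (Contains G T)
Contains? {n} {N} G T = any-function? n resp copy?
  where
  Copy : (Fin n → Fin N) → Set
  Copy f = Injective _≡_ _≡_ f × (∀ {u v} → Edge T u v → Edge G (f u) (f v))
  resp : ∀ {f g} → f ≗ g → Copy f → Copy g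
  resp f≗g (inj , hom) =
    (λ {u} {v} eq → inj (trans (f≗g u) (trans eq (sym (f≗g v))))) ,
    (λ {u} {v} e → subst₂ (Edge G) (f≗g u) (f≗g v) (hom e))
  copy? : ∀ f → Dec (Copy f)
  copy? f =
    map′ (λ h {u} {v} → h u v) (λ h u v → h)
      (Fin.all? λ u → Fin.all? λ v → (f u Fin.≟ f v) →-dec (u Fin.≟ v))
    ×-dec
    map′ (λ h {u} {v} → h u v) (λ h u v → h)
      (Fin.all? λ u → Fin.all? λ v → (adj T u v Bool.≟ true) →-dec (adj G (f u) (f v) Bool.≟ true))

-- Colour all edges of K_r red: there is no blue edge, so T must fit into r vertices.
order≤Ramsey : ∀ {n r a b} (T : Graph (Fin n)) → 1 ≤ a → 1 ≤ b → IsRamseyNumber T (K₂ a b) r → n ≤ r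
order≤Ramsey {n} {r} {suc a} {suc b} T _ _ (arrows , _) with arrows complete
  where
  complete : Graph (Fin r)
  complete = multipartite Fin._≟_ id
... | inj₁ (f , f-inj , _) = Fin.injective⇒≤ {f = f} f-inj
... | inj₂ (f , _ , f-hom) = ⊥-elim (true≢false (f-hom {zero , zero} {suc zero , zero} refl) (no-blue (f (zero , zero)) (f (suc zero , zero))))
  where
  no-blue : ∀ x y → adj (complement (multipartite Fin._≟_ (λ (v : Fin r) → v))) x y ≡ false
  no-blue x y with does (x Fin.≟ y)
  ... | true  = refl
  ... | false = refl

degree : ∀ {N} → Graph (Fin N) → Fin N → ℕ
degree G v = ∣ adj G v ∣

-- Counted in both orientations, an edge contributes once to each of its two ordered pairs, since u
-- < v and v < u exclude each other.
handshake : ∀ {N} (G : Graph (Fin N)) → 2 * e G ≤ ∑ (allFin N) (degree G)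
handshake {N} G = begin
  2 * e G                                                          ≡⟨ cong (λ k → e G + k) (+-identityʳ (e G)) ⟩
  e G + e G                                                        ≡⟨ cong₂ _+_ e≡ (trans e≡ (∑-swap (allFin N) (allFin N) up)) ⟩
  ∑ (allFin N) (λ u → ∑ (allFin N) (up u)) + ∑ (allFin N) (λ u → ∑ (allFin N) (λ v → up v u))
    ≡⟨ ∑-+ (allFin N) _ _ ⟨
  ∑ (allFin N) (λ u → ∑ (allFin N) (up u) + ∑ (allFin N) (λ v → up v u))
    ≡⟨ ∑-cong (allFin N) (λ u → sym (∑-+ (allFin N) _ _)) ⟩
  ∑ (allFin N) (λ u → ∑ (allFin N) (λ v → up u v + up v u))        ≤⟨ ∑-mono (allFin N) (λ u → ∑-mono (allFin N) (once u)) ⟩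
  ∑ (allFin N) (degree G)                                          ∎
  where
  open ≤-Reasoning
  up : Fin N → Fin N → ℕ
  up u v = 𝟙 ((toℕ u <ᵇ toℕ v) ∧ adj G u v)
  e≡ : e G ≡ ∑ (allFin N) (λ u → ∑ (allFin N) (up u))
  e≡ = trans (length-filterᵇ (cartesianProduct (allFin N) (allFin N)) _)
             (∑-product _,_ (allFin N) (allFin N) _)
  once : ∀ u v → up u v + up v u ≤ 𝟙 (adj G u v)
  once u v rewrite adj-sym G v u = pointwise (toℕ u <ᵇ toℕ v) (toℕ v <ᵇ toℕ u) (adj G u v)
    λ u<v v<u → <-asym (does-true (toℕ u <? toℕ v) u<v) (does-true (toℕ v <? toℕ u) v<u)
    where
    pointwise : ∀ a b c → (a ≡ true → b ≡ true → ⊥) → 𝟙 (a ∧ c) + 𝟙 (b ∧ c) ≤ 𝟙 c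
    pointwise true  true  c     asym = ⊥-elim (asym refl refl)
    pointwise true  false true  asym = ≤-refl
    pointwise true  false false asym = z≤n
    pointwise false b     c     asym = 𝟙-mono (λ h → proj₂ (∧-true {b} h))

-- The numbers c + j * q with j < N / q are distinct, below N and congruent to c.
residue-class-≥ : ∀ q N .{{_ : NonZero q}} c → c < q →
                  N / q ≤ ∣ (λ (u : Fin N) → does (c ℕ.≟ toℕ u % q)) ∣
residue-class-≥ q N c c<q = ≤-trans (≤-reflexive (sym length-members))
  (unique-length _ {members} (Unique.map⁺ member-injective (Unique.allFin⁺ (N / q)))
    (All.map⁺ (All.tabulate (λ {j} _ → dec-true (c ℕ.≟ toℕ (member j) % q) (sym (member-class j))))))
  where
  open ≤-Reasoning
  value< : ∀ (j : Fin (N / q)) → c + toℕ j * q < N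
  value< j = begin-strict
    c + toℕ j * q     <⟨ +-monoˡ-< (toℕ j * q) c<q ⟩
    suc (toℕ j) * q   ≤⟨ *-monoˡ-≤ q (Fin.toℕ<n j) ⟩
    N / q * q         ≤⟨ m/n*n≤m N q ⟩
    N                 ∎
  member : Fin (N / q) → Fin N
  member j = Fin.fromℕ< (value< j)
  members : List (Fin N)
  members = map member (allFin (N / q))
  length-members : length members ≡ N / q
  length-members = trans (length-map member (allFin (N / q))) (length-tabulate {n = N / q} id)
  member-injective : ∀ {i j} → member i ≡ member j → i ≡ j
  member-injective {i} {j} eq = Fin.toℕ-injective (*-cancelʳ-≡ (toℕ i) (toℕ j) q (+-cancelˡ-≡ c _ _
    (trans (sym (Fin.toℕ-fromℕ< (value< i))) (trans (cong toℕ eq) (Fin.toℕ-fromℕ< (value< j))))))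
  member-class : ∀ j → toℕ (member j) % q ≡ c
  member-class j = trans (cong (_% q) (Fin.toℕ-fromℕ< (value< j)))
    (trans ([m+kn]%n≡m%n c (toℕ j) q) (m<n⇒m%n≡m c<q))

-- A division-free form of 2 t ≤ (1 - 1/q) N² + N: each vertex misses its own residue class, which
-- has at least the integer part of N/q elements.
turán-≤ : ∀ q N .{{_ : NonZero q}} → q * (2 * t q N) + N * N ≤ N * (q * N + q)
turán-≤ q N = begin
  q * (2 * t q N) + N * N                                   ≤⟨ +-monoˡ-≤ (N * N) (*-monoʳ-≤ q (handshake (turánGraph q N))) ⟩
  q * ∑ (allFin N) (degree (turánGraph q N)) + N * N        ≡⟨ cong₂ _+_ (∑-*ˡ (allFin N) q _) (∑-allFin-const N N) ⟨
  ∑ (allFin N) (λ v → q * degree (turánGraph q N) v) + ∑ (allFin N) (λ _ → N)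
    ≡⟨ ∑-+ (allFin N) _ _ ⟨
  ∑ (allFin N) (λ v → q * degree (turánGraph q N) v + N)    ≤⟨ ∑-mono (allFin N) pointwise ⟩
  ∑ (allFin N) (λ _ → q * N + q)                            ≡⟨ ∑-allFin-const N (q * N + q) ⟩
  N * (q * N + q)                                           ∎
  where
  open ≤-Reasoning
  pointwise : ∀ v → q * degree (turánGraph q N) v + N ≤ q * N + q
  pointwise v = begin
    q * d + N                     ≤⟨ +-monoʳ-≤ (q * d) (≤-trans (≤-reflexive (m≡m%n+[m/n]*n N q)) (+-monoˡ-≤ (N / q * q) (<⇒≤ (m%n<n N q)))) ⟩
    q * d + (q + N / q * q)       ≤⟨ +-monoʳ-≤ (q * d) (+-monoʳ-≤ q (*-monoˡ-≤ q (residue-class-≥ q N (toℕ v % q) (m%n<n (toℕ v) q)))) ⟩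
    q * d + (q + ∣ class ∣ * q)   ≡⟨ regroup q d (∣ class ∣) ⟩
    q * (d + ∣ class ∣) + q       ≡⟨ cong (λ k → q * k + q) total ⟩
    q * N + q                     ∎
    where
    d = degree (turánGraph q N) v
    class : Fin N → Bool
    class u = does (toℕ v % q ℕ.≟ toℕ u % q)
    regroup : ∀ q d c → q * d + (q + c * q) ≡ q * (d + c) + q
    regroup = solve-∀
    total : d + ∣ class ∣ ≡ N
    total = trans (+-comm d _) (trans (sym (∣∣-split full class)) ∣full∣)

2*[NC2]+N≡N*N : ∀ N → 2 * (N C 2) + N ≡ N * N
2*[NC2]+N≡N*N zero    = refl
2*[NC2]+N≡N*N (suc N) = trans (cong (λ k → 2 * k + suc N) (sym (nCk+nC[k+1]≡[n+1]C[k+1] N 1)))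
  (trans (cong (λ k → 2 * (k + (N C 2)) + suc N) (nC1≡n N))
  (trans (regroup N (N C 2)) (trans (cong (λ k → k + (2 * N + 1)) (2*[NC2]+N≡N*N N)) (square N))))
  where
  regroup : ∀ N c → 2 * (N + c) + suc N ≡ 2 * c + N + (2 * N + 1)
  regroup = solve-∀
  square : ∀ N → N * N + (2 * N + 1) ≡ suc N * suc N
  square = solve-∀

module _ where

  open import Data.Integer using (ℤ; +_; +[1+_])

  -- d is the denominator of δ; the numerator is at least 1 and is weakened to 1. The subtracted t
  -- moves to the other side, so that all further estimates are in ℕ.
  clear-denominators : ∀ δ → 0ℚ ℚ.< δ → ∃[ d ] 1 ≤ d × ∀ b t w e →
    (ℕ→ℚ b ℚ.- ℕ→ℚ t) ℚ.+ δ ℚ.* ℕ→ℚ w ℚ.≤ ℕ→ℚ e → d * b + w ≤ d * e + d * t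
  clear-denominators (mkℚ (+ zero)   d-1 _) (ℚ.*<* (ℤ.+<+ ()))
  clear-denominators (mkℚ ℤ.-[1+ _ ] d-1 _) (ℚ.*<* ())
  clear-denominators δ@(mkℚ +[1+ k ] d-1 _) _ = suc d-1 , s≤s z≤n , cleared
    where
    cleared : ∀ b t w e → (ℕ→ℚ b ℚ.- ℕ→ℚ t) ℚ.+ δ ℚ.* ℕ→ℚ w ℚ.≤ ℕ→ℚ e → suc d-1 * b + w ≤ suc d-1 * e + suc d-1 * t
    cleared b t w e h = ≤-trans (+-monoʳ-≤ (d * b) (m≤m+n w (k * w))) (ℤ.drop‿+≤+ (begin
      + (d * b + suc k * w)                                    ≡⟨ trans (ℤ.pos-+ (d * b) (suc k * w)) (cong₂ ℤ._+_ (ℤ.pos-* d b) (ℤ.pos-* (suc k) w)) ⟩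
      + d ℤ.* + b ℤ.+ + suc k ℤ.* + w                          ≡⟨ left (+ d) (+ b) (+ suc k) (+ w) (+ t) ⟩
      lhs (+ d) ℤ.+ + d ℤ.* + t                                ≤⟨ ℤ.+-monoˡ-≤ (+ d ℤ.* + t) integral ⟩
      + e ℤ.* + d ℤ.+ + d ℤ.* + t                              ≡⟨ cong (ℤ._+ + d ℤ.* + t) (ℤ.*-comm (+ e) (+ d)) ⟩
      + d ℤ.* + e ℤ.+ + d ℤ.* + t                              ≡⟨ trans (ℤ.pos-+ (d * e) (d * t)) (cong₂ ℤ._+_ (ℤ.pos-* d e) (ℤ.pos-* d t)) ⟨
      + (d * e + d * t)                                        ∎))
      where
      open ℤ.≤-Reasoning
      d = suc d-1
      -- The cross-multiplied left side in the form in which unnormalised rational arithmetic yields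
      -- it, D being the denominator.
      lhs : ℤ → ℤ
      lhs D = ((+ b ℤ.* + 1 ℤ.+ (ℤ.- + t) ℤ.* + 1) ℤ.* D ℤ.+ (+ suc k ℤ.* + w) ℤ.* + 1) ℤ.* + 1
      left : ∀ d b k w t → d ℤ.* b ℤ.+ k ℤ.* w ≡
             ((b ℤ.* + 1 ℤ.+ (ℤ.- t) ℤ.* + 1) ℤ.* d ℤ.+ (k ℤ.* w) ℤ.* + 1) ℤ.* + 1 ℤ.+ d ℤ.* t
      left = ℤ-Solver.solve-∀
      unnormalised : (toℚᵘ (ℕ→ℚ b) ℚᵘ.+ ℚᵘ.- toℚᵘ (ℕ→ℚ t)) ℚᵘ.+ toℚᵘ δ ℚᵘ.* toℚᵘ (ℕ→ℚ w) ℚᵘ.≤ toℚᵘ (ℕ→ℚ e)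
      unnormalised = ℚᵘ.≤-respˡ-≃
        (ℚᵘ.≃-trans (ℚ.toℚᵘ-homo-+ (ℕ→ℚ b ℚ.- ℕ→ℚ t) (δ ℚ.* ℕ→ℚ w))
          (ℚᵘ.+-cong (ℚᵘ.≃-trans (ℚ.toℚᵘ-homo-+ (ℕ→ℚ b) (ℚ.- ℕ→ℚ t))
                                 (ℚᵘ.+-congʳ (toℚᵘ (ℕ→ℚ b)) (ℚ.toℚᵘ-homo‿- (ℕ→ℚ t))))
                     (ℚ.toℚᵘ-homo-* δ (ℕ→ℚ w))))
        (ℚ.toℚᵘ-mono-≤ h)
      integral : lhs (+ d) ℤ.≤ + e ℤ.* + d
      integral with unnormalised
      ... | *≤* le = subst₂ (λ D D′ → lhs (+ suc D) ℤ.≤ + e ℤ.* + suc D′)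
        (*-identityʳ d-1) (trans (+-identityʳ _) (*-identityʳ d-1)) le

-- The hypotheses, weighted so that everything but the conclusion cancels.
average-degree : ∀ q d n N Δ b t e Σd → 1 ≤ q → 1 ≤ d →
  d * b + N * N ≤ d * e + d * t → 2 * e ≤ Σd → q * (2 * t) + N * N ≤ N * (q * N + q) →
  2 * b + N ≡ N * N → n * q ≤ N + q → 3 * d ≤ N → 2 * d * Δ ≤ N →
  N * (n + Δ + Δ) ≤ Σd
average-degree q d n N Δ b t e Σd q>0 d>0 edges Σd≥ turán binomial N≥ N≥3d N≥2dΔ =
  *-cancelˡ-≤ (q * d) {{>-nonZero (*-mono-≤ q>0 d>0)}}
    (linear 0 (*-monoʳ-≤ (2 * q) edges ⊕ *-monoʳ-≤ (q * d) Σd≥ ⊕ *-monoʳ-≤ d turán ⊕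
               *-monoʳ-≤ (q * d) (≤-reflexive (sym binomial)) ⊕ *-monoʳ-≤ (d * N) N≥ ⊕
               *-monoʳ-≤ (q * N) N≥3d ⊕ *-monoʳ-≤ (q * N) N≥2dΔ)
              (ident q d n N Δ b t e Σd))
  where
  ident : ∀ q d n N Δ b t e S →
    q * d * (N * (n + Δ + Δ)) + (2 * q * (d * e + d * t) + (q * d * S + (d * (N * (q * N + q)) +
      (q * d * (2 * b + N) + (d * N * (N + q) + (q * N * N + q * N * N)))))) + 0 ≡
    q * d * S + (2 * q * (d * b + N * N) + (q * d * (2 * e) + (d * (q * (2 * t) + N * N) +
      (q * d * (N * N) + (d * N * (n * q) + (q * N * (3 * d) + q * N * (2 * d * Δ)))))))
  ident = solve-∀

-- A degree is at most N, and below h outside the set in question, so the excess Δ of the average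
-- over h forces Δ vertices into it.
many-large-degrees : ∀ {N} (G : Graph (Fin N)) h Δ → 1 ≤ N → N * (h + Δ) ≤ ∑ (allFin N) (degree G) →
                     Δ ≤ ∣ (λ v → does (h ≤? degree G v)) ∣
many-large-degrees {N} G h Δ N>0 average = *-cancelˡ-≤ N {{>-nonZero N>0}} (+-cancelʳ-≤ (N * h) _ _ (begin
  N * Δ + N * h                                        ≡⟨ regroup N Δ h ⟩
  N * (h + Δ)                                          ≤⟨ average ⟩
  ∑ (allFin N) (degree G)                              ≤⟨ ∑-mono (allFin N) pointwise ⟩
  ∑ (allFin N) (λ v → N * 𝟙 (D v) + h)                 ≡⟨ ∑-+ (allFin N) _ _ ⟩
  ∑ (allFin N) (λ v → N * 𝟙 (D v)) + ∑ (allFin N) (λ _ → h)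
    ≡⟨ cong₂ _+_ (∑-*ˡ (allFin N) N _) (∑-allFin-const N h) ⟩
  N * ∣ D ∣ + N * h                                    ∎))
  where
  open ≤-Reasoning
  D : Fin N → Bool
  D v = does (h ≤? degree G v)
  regroup : ∀ N Δ h → N * Δ + N * h ≡ N * (h + Δ)
  regroup = solve-∀
  pointwise : ∀ v → degree G v ≤ N * 𝟙 (D v) + h
  pointwise v with D v in Dv
  ... | true  = ≤-trans (∣∣≤n (adj G v)) (≤-trans (≤-reflexive (sym (*-identityʳ N))) (m≤m+n (N * 1) h))
  ... | false = ≤-trans (<⇒≤ (≰⇒> (does-false (h ≤? degree G v) Dv))) (m≤n+m h (N * 0))

-- Clique counts at the scale of n and the choice of constants

^-*-distrib : ∀ a b k → (a * b) ^ k ≡ a ^ k * b ^ k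
^-*-distrib a b zero    = refl
^-*-distrib a b (suc k) = trans (cong (a * b *_) (^-*-distrib a b k)) (interchange a b (a ^ k) (b ^ k))
  where
  interchange : ∀ a b c d → a * b * (c * d) ≡ a * c * (b * d)
  interchange = solve-∀

module _ (q : ℕ) (m : Fin (suc q) → ℕ) (M : ℕ) (m≤M : ∀ i → m i ≤ M) where

  -- The proportion c ^ (q + 1) turns a bound relative to N into one relative to any s ≥ N/c.
  few-cliques-at-scale : ∀ c → 1 ≤ c → ∃[ N₀ ] ∀ N → N₀ ≤ N → 1 ≤ N → (B : Graph (Fin N)) →
    ¬ Contains B (K m) → ∀ s → N ≤ c * s → ∀ S → cliques B (suc q) S < s ^ suc q
  few-cliques-at-scale c c>0 with few-cliques (suc q) m M m≤M (c ^ suc q) (m^n>0 c {{>-nonZero c>0}} (suc q))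
  ... | N₀ , few = N₀ , λ N N≥ N>0 B K⊈B s N≤cs S → ≰⇒> λ many → <⇒≱ (few N N≥ N>0 B K⊈B S) (begin
    N ^ suc q                              ≤⟨ ^-monoˡ-≤ (suc q) N≤cs ⟩
    (c * s) ^ suc q                        ≡⟨ ^-*-distrib c s (suc q) ⟩
    c ^ suc q * s ^ suc q                  ≤⟨ *-monoʳ-≤ (c ^ suc q) many ⟩
    c ^ suc q * cliques B (suc q) S        ∎)
    where open ≤-Reasoning

  -- Compares N, to which the clique bound refers, with n, the scale of the embedding. If n ≤ d for
  -- d = N / (2 (q + 1)), there is no core of minimum degree d, so the complement has d ^ (q + 1)
  -- cliques, a positive proportion of all tuples.
  order-bound : ∃[ N₀ ] ∀ n N → N₀ ≤ N → 1 ≤ n → 1 ≤ N → (T : Graph (Fin n)) → IsTree T → (G : Graph (Fin N)) →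
    ¬ Contains G T → ¬ Contains (complement G) (K m) → N ≤ 2 * suc q * n
  order-bound with few-cliques-at-scale (4 * suc q) (s≤s z≤n)
  ... | N₀ , few = N₀ , bound
    where
    bound : ∀ n N → N₀ ≤ N → 1 ≤ n → 1 ≤ N → (T : Graph (Fin n)) → IsTree T → (G : Graph (Fin N)) →
            ¬ Contains G T → ¬ Contains (complement G) (K m) → N ≤ 2 * suc q * n
    bound n N N≥ n>0 N>0 T tree G T⊈G K⊈Ḡ = ≤-trans (<⇒≤ N<) (*-monoʳ-≤ (2 * suc q) (≰⇒> impossible))
      where
      open ≤-Reasoning
      d : ℕ
      d = N / (2 * suc q)
      N< : N < 2 * suc q * suc d
      N< = begin-strict
        N                                      ≡⟨ m≡m%n+[m/n]*n N (2 * suc q) ⟩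
        N % (2 * suc q) + d * (2 * suc q)      <⟨ +-monoˡ-< (d * (2 * suc q)) (m%n<n N (2 * suc q)) ⟩
        suc d * (2 * suc q)                    ≡⟨ *-comm (suc d) (2 * suc q) ⟩
        2 * suc q * suc d                      ∎
      impossible : ¬ n ≤ d
      impossible n≤d = <⇒≱ (few N N≥ N>0 (complement G) K⊈Ḡ d N≤ full)
        (coreless⇒cliques G d (suc q) full
          (≤-trans (≤-reflexive (rotate d q)) (≤-trans (m/n*n≤m N (2 * suc q)) (≤-reflexive (sym ∣full∣))))
          (no-core G T tree T⊈G n≤d))
        where
        rotate : ∀ d q → 2 * d * suc q ≡ d * (2 * suc q)
        rotate = solve-∀
        -- As 1 ≤ n ≤ d, the rounding in d costs at most a factor 2, whence 4 in place of 2.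
        N≤ : N ≤ 4 * suc q * d
        N≤ = begin
          N                        ≤⟨ <⇒≤ N< ⟩
          2 * suc q * suc d        ≤⟨ *-monoʳ-≤ (2 * suc q) (+-monoˡ-≤ d (≤-trans n>0 n≤d)) ⟩
          2 * suc q * (d + d)      ≡⟨ double q d ⟩
          4 * suc q * d            ∎
          where
          double : ∀ q d → 2 * suc q * (d + d) ≡ 4 * suc q * d
          double = solve-∀

total-loss>0 : ∀ q k → 1 ≤ total-loss q k
total-loss>0 q zero    = s≤s z≤n
total-loss>0 q (suc k) = ≤-trans (m≤n+m 1 (q + 2 + 2 * (2 * (q + 2)) * suc q))
                                 (m≤n+m (loss q) (loss q * total-loss q k))

theorem3p6 : (p : ℕ) → let q = 2 + p in
    (m : Vector ℕ (1 + q)) →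
    1 ≤ m zero →
    (∀ {i j} → i Fin.≤ j → m i ≤ m j) →
    let a = m zero
        b = m (suc zero)
        H = K₂ a b
        F = K m
    in
    (δ : ℚ) → 0ℚ ℚ.< δ →
    ∃[ n₀ ] (∀ (n : ℕ) → n₀ ≤ n →
      (T : Graph (Fin n)) → IsTree T →
      (r : ℕ) → IsRamseyNumber T H r →
      let N = q * (r ∸ 1) + a in
      (G : Graph (Fin N)) →
      ¬ Contains (complement G) F →
      (ℕ→ℚ (N C 2) ℚ.- ℕ→ℚ (t q N)) ℚ.+ δ ℚ.* ℕ→ℚ (N * N) ℚ.≤ ℕ→ℚ (e G) →
      Contains G T)
theorem3p6 p m 1≤a mono δ δ>0 with clear-denominators δ δ>0
... | d , d>0 , cleared = n₀ , main
  where
  open ≤-Reasoning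
  q : ℕ
  q = 2 + p
  m≤M : ∀ i → m i ≤ m (Fin.fromℕ q)
  m≤M i = mono (Fin.≤fromℕ i)
  E : ℕ
  E = total-loss q q
  E>0 : 1 ≤ E
  E>0 = total-loss>0 q q
  -- With s = n / scale and Δ = E * s this gives 2 * d * Δ ≤ n, as the degree estimate requires.
  scale : ℕ
  scale = 2 * d * E
  scale>0 : 1 ≤ scale
  scale>0 = *-mono-≤ (≤-trans d>0 (m≤m+n d _)) E>0
  order = order-bound q m (m (Fin.fromℕ q)) m≤M
  -- N ≤ 2 * suc q * n and n ≤ 2 * scale * s, hence N ≤ c * s.
  c : ℕ
  c = 2 * suc q * (2 * scale)
  c>0 : 1 ≤ c
  c>0 = *-mono-≤ {1} {2 * suc q} (s≤s z≤n) (≤-trans scale>0 (m≤m+n scale _))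
  sparse-cliques = few-cliques-at-scale q m (m (Fin.fromℕ q)) m≤M c c>0
  -- The first summand ensures s ≥ q + 1, the next two are the thresholds of the clique bounds, and
  -- 3 * d absorbs the lower-order terms of the degree estimate.
  n₀ : ℕ
  n₀ = scale * suc q + (proj₁ order + (proj₁ sparse-cliques + 3 * d))

  main : ∀ n → n₀ ≤ n → (T : Graph (Fin n)) → IsTree T →
         (r : ℕ) → IsRamseyNumber T (K₂ (m zero) (m (suc zero))) r →
         let N = q * (r ∸ 1) + m zero in
         (G : Graph (Fin N)) →
         ¬ Contains (complement G) (K m) →
         (ℕ→ℚ (N C 2) ℚ.- ℕ→ℚ (t q N)) ℚ.+ δ ℚ.* ℕ→ℚ (N * N) ℚ.≤ ℕ→ℚ (e G) →
         Contains G T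
  main n n≥ T tree r ramsey G F⊈Ḡ dense = decidable-stable (Contains? G T) contradictory
    where
    N : ℕ
    N = q * (r ∸ 1) + m zero
    s : ℕ
    s = _/_ n scale {{>-nonZero scale>0}}
    Δ : ℕ
    Δ = E * s
    n≤r : n ≤ r
    n≤r = order≤Ramsey T 1≤a (≤-trans 1≤a (mono z≤n)) ramsey
    scale*s≤n : scale * s ≤ n
    scale*s≤n = ≤-trans (≤-reflexive (*-comm scale s)) (m/n*n≤m n scale {{>-nonZero scale>0}})
    n<scale*[1+s] : n < scale * suc s
    n<scale*[1+s] = begin-strict
      n                                          ≡⟨ m≡m%n+[m/n]*n n scale {{>-nonZero scale>0}} ⟩
      _%_ n scale {{>-nonZero scale>0}} + s * scale  <⟨ +-monoˡ-< (s * scale) (m%n<n n scale {{>-nonZero scale>0}}) ⟩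
      suc s * scale                              ≡⟨ *-comm (suc s) scale ⟩
      scale * suc s                              ∎
    q≤s : suc q ≤ s
    q≤s = s≤s⁻¹ (*-cancelˡ-< scale (suc q) (suc s) (≤-<-trans (≤-trans (m≤m+n _ _) n≥) n<scale*[1+s]))
    s>0 : 1 ≤ s
    s>0 = ≤-trans (s≤s z≤n) q≤s
    n>0 : 1 ≤ n
    n>0 = ≤-trans (*-mono-≤ scale>0 s>0) scale*s≤n
    n≤1+[r∸1] : n ≤ suc (r ∸ 1)
    n≤1+[r∸1] = ≤-trans n≤r (m≤n+m∸n r 1)
    nq≤N+q : n * q ≤ N + q
    nq≤N+q = linear (m zero) (*-monoˡ-≤ q n≤1+[r∸1]) (ident n q (r ∸ 1) (m zero))
      where
      ident : ∀ n q r a → n * q + suc r * q + a ≡ q * r + a + q + n * q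
      ident = solve-∀
    n≤N : n ≤ N
    n≤N = linear (p * (r ∸ 1) + (r ∸ 1)) (n≤1+[r∸1] ⊕ 1≤a) (ident n p (r ∸ 1) (m zero))
      where
      ident : ∀ n p r a → n + (suc r + a) + (p * r + r) ≡ (2 + p) * r + a + (n + 1)
      ident = solve-∀
    N>0 : 1 ≤ N
    N>0 = ≤-trans n>0 n≤N
    2dΔ≤n : 2 * d * Δ ≤ n
    2dΔ≤n = ≤-trans (≤-reflexive (sym (*-assoc (2 * d) E s))) scale*s≤n
    Δ≤n : Δ ≤ n
    Δ≤n = ≤-trans (≤-trans (≤-reflexive (sym (*-identityˡ Δ))) (*-monoˡ-≤ Δ (≤-trans d>0 (m≤m+n d _)))) 2dΔ≤n
    -- The average degree is at least n + 2 * Δ: one Δ enters the threshold for D, the other bounds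
    -- the size of D from below.
    D : Fin N → Bool
    D v = does (n + Δ ≤? degree G v)
    D-large : Δ ≤ ∣ D ∣
    D-large = many-large-degrees G (n + Δ) Δ N>0
      (average-degree q d n N Δ (N C 2) (t q N) (e G) _ (s≤s z≤n) d>0
        (cleared (N C 2) (t q N) (N * N) (e G) dense) (handshake G) (turán-≤ q N) (2*[NC2]+N≡N*N N)
        nq≤N+q (≤-trans 3d≤n n≤N) (≤-trans 2dΔ≤n n≤N))
      where
      3d≤n : 3 * d ≤ n
      3d≤n = ≤-trans (m≤n+m (3 * d) (proj₁ sparse-cliques)) (≤-trans (m≤n+m _ (proj₁ order)) (≤-trans (m≤n+m _ (scale * suc q)) n≥))
    contradictory : ¬ ¬ Contains G T
    -- The induction starts with all of G and allowance s: r ≥ n yields N ≥ q * (n - 1), and the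
    -- shortfall q is covered by s ≥ q + 1.
    contradictory T⊈G = <⇒≱ (few full)
      (stability G T tree T⊈G q s s>0 few Δ Δ≤n D (λ {v} → does-true (n + Δ ≤? degree G v))
        q s full ≤-refl ≤-refl ≤-refl
        (≤-trans D-large (∣∣-mono {N} {D} {D ∩ full} (λ v Dv → true-∧ Dv refl)))
        (≤-trans nq≤N+q (≤-trans (+-monoʳ-≤ N (≤-trans (n≤1+n q) q≤s)) (≤-reflexive (cong (_+ s) (sym (∣full∣ {N})))))))
      where
      N≤cs : N ≤ c * s
      N≤cs = begin
        N                                    ≤⟨ proj₂ order n N (≤-trans (≤-trans (m≤m+n _ _) (≤-trans (m≤n+m _ (scale * suc q)) n≥)) n≤N) n>0 N>0 T tree G T⊈G F⊈Ḡ ⟩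
        2 * suc q * n                        ≤⟨ *-monoʳ-≤ (2 * suc q) (<⇒≤ n<scale*[1+s]) ⟩
        2 * suc q * (scale * suc s)          ≤⟨ *-monoʳ-≤ (2 * suc q) (*-monoʳ-≤ scale (+-monoˡ-≤ s s>0)) ⟩
        2 * suc q * (scale * (s + s))        ≡⟨ double (2 * suc q) scale s ⟩
        c * s                                ∎
        where
        double : ∀ a k s → a * (k * (s + s)) ≡ a * (2 * k) * s
        double = solve-∀
      few : ∀ S → cliques (complement G) (suc q) S < s ^ suc q
      few = proj₂ sparse-cliques N
        (≤-trans (≤-trans (m≤m+n (proj₁ sparse-cliques) (3 * d)) (≤-trans (m≤n+m _ (proj₁ order)) (≤-trans (m≤n+m _ (scale * suc q)) n≥))) n≤N)
        N>0 (complement G) F⊈Ḡ s N≤cs
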